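{- Let $m \ge 1$ and let $a_i, b_i \ge 2$ be integers for $1 \le i \le m$. Let $\{(A_i, B_i)\}_{i=1}^m$ be a system of pairs of finite sets such that $A_i \cap B_i = \emptyset$ for every $1 \le i \le m$, $|A_i \cap B_j| = 1$ for every $1 \le i \ne j \le m$, and $|A_i| \le a_i$, $|B_i| \le b_i$ for every $1 \le i \le m$. Then \[ \sum_{i=1}^m \frac{1}{\binom{a_i + b_i}{a_i}} \le \frac{29}{30}. \] -}

module Defs where

open import Data.Nat using (ℕ; zero; suc)
open import Data.Fin using (Fin; zero; suc)
open import Data.Integer using (+_)
open import Data.Rational using (ℚ; 0ℚ; _+_; _/_)

-- Reciprocal of a natural number as a rational; 1/0 is set to 0 by convention
-- (only ever applied to binomial coefficients, which are ≥ 1).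
recip : ℕ → ℚ
recip zero    = 0ℚ
recip (suc k) = (+ 1) / suc k

sumℚ : (m : ℕ) → (Fin m → ℚ) → ℚ
sumℚ zero    f = 0ℚ
sumℚ (suc m) f = f zero + sumℚ m (λ i → f (suc i))

{-# OPTIONS --safe #-}

-- Order the ground set uniformly at random. The pair (A, B) separates an order if A comes before B; this has
-- probability 1 / C(|A| + |B|, |A|), and an order is separated by at most one pair, which is Bollobás' bound 1. So it
-- suffices to find orders of total probability 1/30 that no pair separates. (Fresh points make |Aᵢ| = aᵢ, |Bᵢ| = bᵢ.)
--
-- If all |Bᵢ| ≥ 3, condition on the last point z: the pairs with z ∉ Aᵢ, restricted to the other points, again satisfy
-- the hypotheses, so induction applies; symmetrically if all |Aᵢ| ≥ 3. Two situations remain.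
--
-- * Some pair is ({x, x′}, {y, y′}). An order with x′ < y < x < y′ is separated only by pairs with y ∈ A and x ∈ B.
--   Unless ({y, x′}, {x, y′}) is one of them, deleting the four points from these pairs leaves sizes (a, b) ≠ (0, 0),
--   and they separate at most 1/40 of all orders in this way, out of the 1/24 with x′ < y < x < y′: the deleted system
--   still satisfies Bollobás' bound, and 10 C(a + b, a) ≤ C(a + b + 4, a + 2). Since ({y, x′}, {x, y′}) and
--   ({y′, x}, {x′, y}) would intersect in two points, this happens for two of the four choices of (x, y), which
--   leaves 2 (1/24 - 1/40) = 1/30.
--
-- * Some |Bᵢ| = 2 < |Aᵢ| and some |Aₖ| = 2 < |Bₖ|. Then Aₖ = {x, z} and Bᵢ = {z, y}, and only the pairs i and k
--   separate orders with x < z < y, each at most 1/20 of all orders, which leaves 1/6 - 1/10.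
module Submission where

open import Defs
open import Data.Bool using (Bool; true; false; _∧_; not; if_then_else_)
open import Data.Bool.Properties using (∧-comm) renaming (_≟_ to _≟ᵇ_)
open import Data.Empty using () renaming (⊥ to Empty)
open import Data.Fin using (Fin; zero; suc; punchIn; punchOut; _≟_)
open import Data.Fin.Permutation using (Permutation; _⟨$⟩ʳ_; remove; transpose; punchIn-permute)
import Data.Fin.Permutation.Components as Components
import Data.Fin.Properties as Fin
open import Data.Fin.Properties using (all?; any?; punchIn-punchOut; punchInᵢ≢i; punchIn-injective)
open import Data.Fin.Subset using (Subset; _∩_; ∣_∣; ⊥)
open import Data.Integer using (+_)
import Data.Integer as ℤ
import Data.Integer.Properties as ℤ
open import Data.Integer.Tactic.RingSolver using () renaming (solve-∀ to ℤ-solve-∀)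
open import Data.Nat using (ℕ; zero; suc; pred; _+_; _*_; _∸_; _≤_; _<_; z≤n; s≤s; _<?_; _!)
import Data.Nat as ℕ
open import Data.Nat.Combinatorics using (_C_; nCk≡n!/k![n-k]!; k![n∸k]!∣n!)
open import Data.Nat.DivMod using (m/n*n≡m)
open import Data.Nat.Properties hiding (_≟_)
open import Data.Nat.Tactic.RingSolver using (solve-∀)
open import Data.Product using (∃; _×_; _,_; proj₁; proj₂)
open import Data.Rational using (ℚ; fromℚᵘ; toℚᵘ; _/_) renaming (_≤_ to _≤ℚ_; _+_ to _+ℚ_)
open import Data.Rational.Properties using (toℚᵘ-injective; toℚᵘ-homo-+; toℚᵘ-fromℚᵘ; toℚᵘ-cancel-≤; fromℚᵘ-cong)
open import Data.Rational.Unnormalised using (mkℚᵘ; *≡*; *≤*)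
import Data.Rational.Unnormalised as ℚᵘ
import Data.Rational.Unnormalised.Properties as ℚᵘ
open import Data.Sum using (_⊎_; inj₁; inj₂; swap)
open import Data.Unit using (⊤; tt)
open import Data.Vec using (lookup; []; _∷_)
open import Data.Vec.Properties using (lookup-zipWith; lookup-replicate)
open import Function using (_∘_; case_of_)
open import Relation.Binary.PropositionalEquality using (_≡_; _≢_; refl; sym; trans; cong; cong₂; subst; subst₂; module ≡-Reasoning)
open import Relation.Nullary using (¬_; Dec; yes; no; ⌊_⌋; ¬?; _×-dec_; _⊎-dec_; _→-dec_; contradiction)
open import Relation.Unary using (Decidable)
open import Algebra.Properties.CommutativeMonoid.Sum +-0-commutativeMonoid
  using (sum; sum-cong-≗; sum-remove; sum-permute; ∑-comm; ∑-distrib-+)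
open import Algebra.Properties.Semiring.Sum +-*-semiring using (*-distribˡ-sum; *-distribʳ-sum)

private variable
  m n : ℕ
  P Q : Set

-- Indicators and finite sums

ι : Dec P → ℕ
ι (yes _) = 1
ι (no _)  = 0

ι-mono : (P → Q) → (p : Dec P) (q : Dec Q) → ι p ≤ ι q
ι-mono f (yes p) (yes q) = ≤-refl
ι-mono f (yes p) (no ¬q) = contradiction (f p) ¬q
ι-mono f (no _)  q       = z≤n

ι-cong : (P → Q) → (Q → P) → (p : Dec P) (q : Dec Q) → ι p ≡ ι q
ι-cong f g p q = ≤-antisym (ι-mono f p q) (ι-mono g q p)

ι-true : P → (p : Dec P) → ι p ≡ 1
ι-true p (yes _) = refl
ι-true p (no ¬p) = contradiction p ¬p

ι-false : ¬ P → (p : Dec P) → ι p ≡ 0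
ι-false ¬p (yes p) = contradiction p ¬p
ι-false ¬p (no _)  = refl

ι-split : (p : Dec P) (q : Dec Q) → ι p ≡ ι (p ×-dec q) + ι (p ×-dec ¬? q)
ι-split (yes _) (yes _) = refl
ι-split (yes _) (no _)  = refl
ι-split (no _)  _       = refl

sum-mono : (f g : Fin n → ℕ) → (∀ i → f i ≤ g i) → sum f ≤ sum g
sum-mono {zero}  f g f≤g = z≤n
sum-mono {suc n} f g f≤g = +-mono-≤ (f≤g zero) (sum-mono (f ∘ suc) (g ∘ suc) (f≤g ∘ suc))

sum-const : ∀ n c → sum {n} (λ _ → c) ≡ n * c
sum-const zero    c = refl
sum-const (suc n) c = cong (λ k → c + k) (sum-const n c)

sum-zero : {f : Fin n → ℕ} → (∀ i → f i ≡ 0) → sum f ≡ 0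
sum-zero {n} f≡0 = trans (sum-cong-≗ f≡0) (trans (sum-const n 0) (*-zeroʳ n))

sum-disjoint : {R : Fin n → Set} (R? : Decidable R) → (∀ {i j} → R i → R j → i ≡ j) → sum (λ i → ι (R? i)) ≤ 1
sum-disjoint {zero}  R? unique = z≤n
sum-disjoint {suc n} R? unique with R? zero
... | no _   = sum-disjoint (R? ∘ suc) λ r s → Fin.suc-injective (unique r s)
... | yes r₀ = s≤s (≤-reflexive (sum-zero λ i → ι-false (λ r → contradiction (unique r₀ r) Fin.0≢1+n) (R? (suc i))))

-- Finite sets

infix 4 _∈_ _∈?_
infixl 6 _─_ _⊹_

-- Boolean-valued functions, so that removing the point `z` from the ground set is composition with
-- `punchIn z`.
FinSet : ℕ → Set
FinSet n = Fin n → Bool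

_∈_ : Fin n → FinSet n → Set
z ∈ A = A z ≡ true

_∈?_ : (z : Fin n) (A : FinSet n) → Dec (z ∈ A)
z ∈? A = A z ≟ᵇ true

card : FinSet n → ℕ
card A = sum (λ z → ι (z ∈? A))

Disjoint : FinSet n → FinSet n → Set
Disjoint A B = ∀ z → z ∈ A → z ∈ B → Empty

_∩ᶠ_ : FinSet n → FinSet n → FinSet n
(A ∩ᶠ B) z = A z ∧ B z

∈-∩⁺ : ∀ (A B : FinSet n) {z} → z ∈ A → z ∈ B → z ∈ (A ∩ᶠ B)
∈-∩⁺ A B p q rewrite p | q = refl

∈-∩⁻ : ∀ (A B : FinSet n) {z} → z ∈ (A ∩ᶠ B) → z ∈ A × z ∈ B
∈-∩⁻ A B {z} p with A z | B z
... | true | true = refl , refl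

card-punchIn : ∀ (A : FinSet (suc n)) z → card A ≡ ι (z ∈? A) + card (A ∘ punchIn z)
card-punchIn A z = sum-remove {i = z} (λ u → ι (u ∈? A))

card-cong : ∀ (A B : FinSet n) → (∀ z → A z ≡ B z) → card A ≡ card B
card-cong A B A≗B = sum-cong-≗ λ z → cong (λ b → ι (b ≟ᵇ true)) (A≗B z)

card-∩-comm : ∀ (A B : FinSet n) → card (A ∩ᶠ B) ≡ card (B ∩ᶠ A)
card-∩-comm A B = card-cong (A ∩ᶠ B) (B ∩ᶠ A) λ z → ∧-comm (A z) (B z)

card-insert : ∀ (A B : FinSet n) z → ¬ z ∈ A → z ∈ B → (∀ {u} → u ≢ z → A u ≡ B u) → card B ≡ suc (card A)
card-insert {suc n} A B z z∉A z∈B A≈B = begin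
  card B                                ≡⟨ card-punchIn B z ⟩
  ι (z ∈? B) + card (B ∘ punchIn z)     ≡⟨ cong (_+ card (B ∘ punchIn z)) (ι-true z∈B (z ∈? B)) ⟩
  suc (card (B ∘ punchIn z))            ≡⟨ cong suc (card-cong _ _ λ u → sym (A≈B (punchInᵢ≢i z u))) ⟩
  suc (card (A ∘ punchIn z))            ≡⟨ cong (λ k → suc (k + card (A ∘ punchIn z))) (sym (ι-false z∉A (z ∈? A))) ⟩
  suc (ι (z ∈? A) + card (A ∘ punchIn z)) ≡⟨ cong suc (sym (card-punchIn A z)) ⟩
  suc (card A)                          ∎
  where open ≡-Reasoning

-- Abstract, so that the set and the points can be inferred from a membership.
abstract

  _─_ : FinSet n → Fin n → FinSet n
  (A ─ z) u = if ⌊ u ≟ z ⌋ then false else A u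

  _⊹_ : FinSet n → Fin n → FinSet n
  (A ⊹ z) u = if ⌊ u ≟ z ⌋ then true else A u

  ∈-─⁺ : ∀ (A : FinSet n) {z u} → u ∈ A → u ≢ z → u ∈ A ─ z
  ∈-─⁺ A {z} {u} p u≢z with u ≟ z
  ... | yes u≡z = contradiction u≡z u≢z
  ... | no _    = p

  ∈-─⁻ : ∀ (A : FinSet n) {z u} → u ∈ A ─ z → u ∈ A × u ≢ z
  ∈-─⁻ A {z} {u} p with u ≟ z
  ... | no u≢z = p , u≢z

  ∈-⊹-new : ∀ (A : FinSet n) z → z ∈ A ⊹ z
  ∈-⊹-new A z with z ≟ z
  ... | yes _   = refl
  ... | no z≢z = contradiction refl z≢z

  ∈-⊹-old : ∀ (A : FinSet n) {z u} → u ∈ A → u ∈ A ⊹ z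
  ∈-⊹-old A {z} {u} p with u ≟ z
  ... | yes _ = refl
  ... | no _  = p

  ∈-⊹⁻ : ∀ (A : FinSet n) {z u} → u ∈ A ⊹ z → u ≡ z ⊎ u ∈ A
  ∈-⊹⁻ A {z} {u} p with u ≟ z
  ... | yes u≡z = inj₁ u≡z
  ... | no _    = inj₂ p

  card-─ : ∀ (A : FinSet n) {z} → z ∈ A → card A ≡ suc (card (A ─ z))
  card-─ A {z} z∈A = card-insert (A ─ z) A z (λ p → proj₂ (∈-─⁻ A p) refl) z∈A agree
    where
    agree : ∀ {u} → u ≢ z → (A ─ z) u ≡ A u
    agree {u} u≢z with u ≟ z
    ... | yes u≡z = contradiction u≡z u≢z
    ... | no _    = refl

  card-⊹ : ∀ (A : FinSet n) {z} → ¬ z ∈ A → card (A ⊹ z) ≡ suc (card A)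
  card-⊹ A {z} z∉A = card-insert A (A ⊹ z) z z∉A (∈-⊹-new A z) agree
    where
    agree : ∀ {u} → u ≢ z → A u ≡ (A ⊹ z) u
    agree {u} u≢z with u ≟ z
    ... | yes u≡z = contradiction u≡z u≢z
    ... | no _    = refl

∈⇒card>0 : ∀ (A : FinSet n) {z} → z ∈ A → 0 < card A
∈⇒card>0 A z∈A = subst (0 <_) (sym (card-─ A z∈A)) (s≤s z≤n)

card>0⇒∃ : ∀ (A : FinSet n) → 0 < card A → ∃ λ z → z ∈ A
card>0⇒∃ A 0<a with any? (_∈? A)
... | yes z∈A = z∈A
... | no ∄    = contradiction 0<a (<-irrefl (sym (sum-zero λ z → ι-false (λ p → ∄ (z , p)) (z ∈? A))))

card≡1⇒unique : ∀ (A : FinSet n) → card A ≡ 1 → ∀ {u v} → u ∈ A → v ∈ A → u ≡ v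
card≡1⇒unique A a≡1 {u} {v} u∈A v∈A with v ≟ u
... | yes v≡u = sym v≡u
... | no v≢u  = contradiction (suc-injective (trans (sym (card-─ A u∈A)) a≡1))
                              (>⇒≢ (∈⇒card>0 (A ─ u) (∈-─⁺ A v∈A v≢u)))

card≡2⇒pair : ∀ (A : FinSet n) → card A ≡ 2 → ∀ {u} → u ∈ A →
              ∃ λ v → v ∈ A × u ≢ v × (∀ {w} → w ∈ A → w ≡ u ⊎ w ≡ v)
card≡2⇒pair A a≡2 {u} u∈A with suc-injective (trans (sym (card-─ A u∈A)) a≡2)
... | a′≡1 with card>0⇒∃ (A ─ u) (≤-reflexive (sym a′≡1))
... | v , v∈A′ = v , proj₁ (∈-─⁻ A v∈A′) , (λ u≡v → proj₂ (∈-─⁻ A v∈A′) (sym u≡v)) , only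
  where
  only : ∀ {w} → w ∈ A → w ≡ u ⊎ w ≡ v
  only {w} w∈A with w ≟ u
  ... | yes w≡u = inj₁ w≡u
  ... | no w≢u  = inj₂ (card≡1⇒unique (A ─ u) a′≡1 (∈-─⁺ A w∈A w≢u) v∈A′)

-- Linear orders

infixr 5 _∷_

-- z ∷ o places z after the points of o, which are renamed by punchIn z.
data Order : ℕ → Set where
  []  : Order zero
  _∷_ : Fin (suc n) → Order n → Order (suc n)

rank : Order n → Fin n → ℕ
rank {suc n} (z ∷ o) i with z ≟ i
... | yes _  = n
... | no z≢i = rank o (punchOut z≢i)

rank-last : ∀ z (o : Order n) → rank (z ∷ o) z ≡ n
rank-last z o with z ≟ z
... | yes _   = refl
... | no z≢z = contradiction refl z≢z

rank-punchIn : ∀ z (o : Order n) i → rank (z ∷ o) (punchIn z i) ≡ rank o i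
rank-punchIn z o i with z ≟ punchIn z i
... | yes z≡  = contradiction (sym z≡) (punchInᵢ≢i z i)
... | no z≢   = cong (rank o) (punchIn-injective z _ _ (punchIn-punchOut z≢))

-- Splits the points ranked by `z ∷ o` so that `rank-last` or `rank-punchIn` applies.
data View (z : Fin (suc n)) : Fin (suc n) → Set where
  here  : View z z
  there : ∀ i → View z (punchIn z i)

view : ∀ (z i : Fin (suc n)) → View z i
view z i with z ≟ i
... | yes refl = here
... | no z≢i   = subst (View z) (punchIn-punchOut z≢i) (there (punchOut z≢i))

rank< : ∀ (o : Order n) i → rank o i < n
rank< (z ∷ o) i with z ≟ i
... | yes _  = ≤-refl
... | no z≢i = m<n⇒m<1+n (rank< o (punchOut z≢i))

rank-injective : ∀ (o : Order n) {i j} → rank o i ≡ rank o j → i ≡ j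
rank-injective (z ∷ o) {i} {j} eq with view z i | view z j
... | here    | here    = refl
... | here    | there j = contradiction (trans (sym (rank-punchIn z o j)) (trans (sym eq) (rank-last z o))) (<⇒≢ (rank< o j))
... | there i | here    = contradiction (trans (sym (rank-punchIn z o i)) (trans eq (rank-last z o))) (<⇒≢ (rank< o i))
... | there i | there j = cong (punchIn z) (rank-injective o (trans (sym (rank-punchIn z o i)) (trans eq (rank-punchIn z o j))))

-- Every linear order arises exactly once from its last point and the order of the rest, so this is
-- n! times the mean over a uniformly random order.
∑ₒ : (Order n → ℕ) → ℕ
∑ₒ {zero}  f = f []
∑ₒ {suc n} f = sum λ z → ∑ₒ λ o → f (z ∷ o)

∑ₒ-mono : (f g : Order n → ℕ) → (∀ o → f o ≤ g o) → ∑ₒ f ≤ ∑ₒ g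
∑ₒ-mono {zero}  f g f≤g = f≤g []
∑ₒ-mono {suc n} f g f≤g = sum-mono _ _ λ z → ∑ₒ-mono _ _ λ o → f≤g (z ∷ o)

∑ₒ-cong : (f g : Order n → ℕ) → (∀ o → f o ≡ g o) → ∑ₒ f ≡ ∑ₒ g
∑ₒ-cong f g f≗g = ≤-antisym (∑ₒ-mono f g (≤-reflexive ∘ f≗g)) (∑ₒ-mono g f (≤-reflexive ∘ sym ∘ f≗g))

∑ₒ-const : ∀ n c → ∑ₒ {n} (λ _ → c) ≡ n ! * c
∑ₒ-const zero    c = sym (*-identityˡ c)
∑ₒ-const (suc n) c = trans (sum-cong-≗ {suc n} λ _ → ∑ₒ-const n c)
                           (trans (sum-const (suc n) (n ! * c)) (sym (*-assoc (suc n) (n !) c)))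

∑ₒ-distrib-+ : (f g : Order n → ℕ) → ∑ₒ (λ o → f o + g o) ≡ ∑ₒ f + ∑ₒ g
∑ₒ-distrib-+ {zero}  f g = refl
∑ₒ-distrib-+ {suc n} f g = trans (sum-cong-≗ λ z → ∑ₒ-distrib-+ (λ o → f (z ∷ o)) (λ o → g (z ∷ o)))
                                 (∑-distrib-+ (λ z → ∑ₒ λ o → f (z ∷ o)) (λ z → ∑ₒ λ o → g (z ∷ o)))

∑ₒ-comm-sum : (f : Fin m → Order n → ℕ) → sum (λ i → ∑ₒ (f i)) ≡ ∑ₒ (λ o → sum (λ i → f i o))
∑ₒ-comm-sum {n = zero}  f = refl
∑ₒ-comm-sum {n = suc n} f = trans (∑-comm λ i z → ∑ₒ λ o → f i (z ∷ o))
                                  (sum-cong-≗ λ z → ∑ₒ-comm-sum λ i o → f i (z ∷ o))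

-- Renames the points by `π`. Below the last point `z`, `remove z π` is the bijection that `π`
-- induces between the remaining points.
act : Permutation n n → Order n → Order n
act π []      = []
act π (z ∷ o) = (π ⟨$⟩ʳ z) ∷ act (remove z π) o

rank-act : ∀ (π : Permutation n n) o i → rank (act π o) (π ⟨$⟩ʳ i) ≡ rank o i
rank-act π (z ∷ o) i with view z i
... | here    = trans (rank-last (π ⟨$⟩ʳ z) (act (remove z π) o)) (sym (rank-last z o))
... | there j rewrite punchIn-permute π z j =
  trans (rank-punchIn (π ⟨$⟩ʳ z) (act (remove z π) o) (remove z π ⟨$⟩ʳ j))
        (trans (rank-act (remove z π) o j) (sym (rank-punchIn z o j)))

-- Renaming permutes the orders: the inner sums are invariant by induction for `remove z π`, and the
-- outer sum is reindexed along `π`.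
∑ₒ-act : ∀ (π : Permutation n n) (f : Order n → ℕ) → ∑ₒ (f ∘ act π) ≡ ∑ₒ f
∑ₒ-act {zero}  π f = refl
∑ₒ-act {suc n} π f = trans (sum-cong-≗ λ z → ∑ₒ-act (remove z π) λ o → f ((π ⟨$⟩ʳ z) ∷ o))
                           (sym (sum-permute (λ z → ∑ₒ λ o → f (z ∷ o)) π))

-- Counting orders

count : {R : Order n → Set} → Decidable R → ℕ
count R? = ∑ₒ λ o → ι (R? o)

module _ {R S : Order n → Set} (R? : Decidable R) (S? : Decidable S) where

  count-mono : (∀ {o} → R o → S o) → count R? ≤ count S?
  count-mono R⊆S = ∑ₒ-mono _ _ λ o → ι-mono R⊆S (R? o) (S? o)

  count-cong : (∀ {o} → R o → S o) → (∀ {o} → S o → R o) → count R? ≡ count S?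
  count-cong R⊆S S⊆R = ∑ₒ-cong _ _ λ o → ι-cong R⊆S S⊆R (R? o) (S? o)

  count-split : count R? ≡ count (λ o → R? o ×-dec S? o) + count (λ o → R? o ×-dec ¬? (S? o))
  count-split = trans (∑ₒ-cong _ _ λ o → ι-split (R? o) (S? o)) (∑ₒ-distrib-+ _ (λ o → ι (R? o ×-dec ¬? (S? o))))

count-none : {R : Order n → Set} (R? : Decidable R) → (∀ {o} → ¬ R o) → count R? ≡ 0
count-none {n} R? ¬R = trans (∑ₒ-cong _ _ λ o → ι-false ¬R (R? o)) (trans (∑ₒ-const n 0) (*-zeroʳ (n !)))

count-all : {R : Order n → Set} (R? : Decidable R) → (∀ {o} → R o) → count R? ≡ n !
count-all {n} R? r = trans (∑ₒ-cong _ _ λ o → ι-true r (R? o)) (trans (∑ₒ-const n 1) (*-identityʳ (n !)))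

_before_ : Fin n → Fin n → Order n → Set
(u before v) o = rank o u < rank o v

before? : (u v : Fin n) → Decidable (u before v)
before? u v o = rank o u <? rank o v

-- Orders separated by a pair

_≺_ : FinSet n → FinSet n → Order n → Set
(A ≺ B) o = ∀ u v → u ∈ A → v ∈ B → (u before v) o

≺? : (A B : FinSet n) → Decidable (A ≺ B)
≺? A B o = all? λ u → all? λ v → (u ∈? A) →-dec ((v ∈? B) →-dec before? u v o)

module _ (A B : FinSet (suc n)) (z : Fin (suc n)) where

  count-last-∈ : z ∈ A → 0 < card B → count (λ o → ≺? A B (z ∷ o)) ≡ 0
  count-last-∈ z∈A 0<b with card>0⇒∃ B 0<b
  ... | v , v∈B = count-none (λ o → ≺? A B (z ∷ o)) λ {o} A≺B →
    <⇒≱ (subst (_< rank (z ∷ o) v) (rank-last z o) (A≺B z v z∈A v∈B)) (≤-pred (rank< (z ∷ o) v))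

  count-last-∉ : ¬ z ∈ A → count (λ o → ≺? A B (z ∷ o)) ≡ count (≺? (A ∘ punchIn z) (B ∘ punchIn z))
  count-last-∉ z∉A = count-cong (λ o → ≺? A B (z ∷ o)) (≺? (A ∘ punchIn z) (B ∘ punchIn z)) to from
    where
    to : ∀ {o} → (A ≺ B) (z ∷ o) → ((A ∘ punchIn z) ≺ (B ∘ punchIn z)) o
    to {o} A≺B u v u∈ v∈ rewrite sym (rank-punchIn z o u) | sym (rank-punchIn z o v) = A≺B _ _ u∈ v∈
    from : ∀ {o} → ((A ∘ punchIn z) ≺ (B ∘ punchIn z)) o → (A ≺ B) (z ∷ o)
    from {o} A≺B u v u∈A v∈B with view z u | view z v
    ... | here    | _       = contradiction u∈A z∉A
    ... | there i | here    rewrite rank-punchIn z o i | rank-last z o = rank< o i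
    ... | there i | there j rewrite rank-punchIn z o i | rank-punchIn z o j = A≺B i j u∈A v∈B

-- Conditioning on the last point `z`: if it is in `A`, it fails to precede the points of `B`;
-- otherwise it imposes no condition and can be deleted.
count-reveal : ∀ (A B : FinSet (suc n)) → 0 < card B →
  count (≺? A B) ≡ sum λ z → ι (¬? (z ∈? A)) * count (≺? (A ∘ punchIn z) (B ∘ punchIn z))
count-reveal A B 0<b = sum-cong-≗ term
  where
  term : ∀ z → count (λ o → ≺? A B (z ∷ o)) ≡ ι (¬? (z ∈? A)) * count (≺? (A ∘ punchIn z) (B ∘ punchIn z))
  term z with z ∈? A
  ... | yes z∈A = count-last-∈ A B z z∈A 0<b
  ... | no z∉A  = trans (count-last-∉ A B z z∉A) (sym (*-identityˡ _))

-- For empty `B` all orders count. Otherwise consider the last point: in `A` it rules the order out,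
-- in `B` it lowers |B| by one, elsewhere it changes neither size. The outcome is the probability 1
-- / C(|A| + |B|, |A|), with denominators cleared.
count-≺ : ∀ (A B : FinSet n) → Disjoint A B → count (≺? A B) * (card A + card B) ! ≡ n ! * (card A ! * card B !)
count-≺ {n} A B A#B with card B in b≡
... | zero = trans (cong₂ _*_ (count-all (≺? A B) λ u v _ v∈B → contradiction b≡ (>⇒≢ (∈⇒card>0 B v∈B)))
                              (cong _! (+-identityʳ (card A))))
                   (cong (n ! *_) (sym (*-identityʳ (card A !))))
count-≺ {suc n} A B A#B | suc b = +-cancelʳ-≡ (c * card A) _ _ (begin
    count (≺? A B) * F + c * card A                              ≡⟨ cong₂ _+_ (*-distribʳ-sum F term) (*-distribˡ-sum c (λ z → ι (z ∈? A))) ⟩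
    sum (λ z → term z * F) + sum (λ z → c * ι (z ∈? A))          ≡⟨ sym (∑-distrib-+ (λ z → term z * F) (λ z → c * ι (z ∈? A))) ⟩
    sum (λ z → term z * F + c * ι (z ∈? A))                      ≡⟨ sum-cong-≗ balance ⟩
    sum (λ z → c + d * ι (z ∈? B))                               ≡⟨ ∑-distrib-+ {suc n} (λ _ → c) (λ z → d * ι (z ∈? B)) ⟩
    sum {suc n} (λ _ → c) + sum (λ z → d * ι (z ∈? B))           ≡⟨ cong₂ _+_ (sum-const (suc n) c) (sym (*-distribˡ-sum d (λ z → ι (z ∈? B)))) ⟩
    suc n * c + d * card B                                       ≡⟨ cong (λ k → suc n * c + d * k) b≡ ⟩
    suc n * c + d * suc b                                        ≡⟨ regroup (suc n) (n !) (card A !) (b !) (suc b) (card A) ⟩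
    (suc n) ! * (card A ! * (suc b) !) + c * card A              ∎)
  where
  open ≡-Reasoning
  F c d : ℕ
  F = (card A + suc b) !
  c = n ! * (card A ! * b !) * suc b
  d = n ! * (card A ! * b !) * card A
  term : Fin (suc n) → ℕ
  term z = count λ o → ≺? A B (z ∷ o)
  regroup : ∀ N f x y s a → N * (f * (x * y) * s) + f * (x * y) * a * s ≡ N * f * (x * (s * y)) + f * (x * y) * s * a
  regroup = solve-∀
  -- A point outside both sets contributes `c`, and a point of `B` contributes `c + d`. A point of
  -- `A` contributes nothing and is credited `c`, so that the points outside both sets need not be
  -- counted. In total the credits `c * card A` equal the corrections `d * card B` and cancel.
  balance : ∀ z → term z * F + c * ι (z ∈? A) ≡ c + d * ι (z ∈? B)
  balance z with z ∈? A | z ∈? B | card-punchIn A z | card-punchIn B z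
  ... | yes z∈A | yes z∈B | _ | _ = contradiction z∈B (A#B z z∈A)
  ... | yes z∈A | no _ | _ | _
    rewrite count-last-∈ A B z z∈A (subst (0 <_) (sym b≡) (s≤s z≤n)) = lemma c d
    where
    lemma : ∀ c d → c * 1 ≡ c + d * 0
    lemma = solve-∀
  ... | no z∉A | yes z∈B | a≡ | b≡′ = begin
      term z * F + c * 0                                   ≡⟨ cong₂ (λ t f → t * f ! + c * 0) (count-last-∉ A B z z∉A) (+-suc (card A) b) ⟩
      t * (suc (card A + b) * (card A + b) !) + c * 0      ≡⟨ lemma₁ t (suc (card A + b)) _ c ⟩
      t * (card A + b) ! * suc (card A + b)                ≡⟨ cong (_* suc (card A + b)) ih ⟩
      n ! * (card A ! * b !) * suc (card A + b)            ≡⟨ cong (n ! * (card A ! * b !) *_) (sym (+-suc (card A) b)) ⟩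
      n ! * (card A ! * b !) * (card A + suc b)            ≡⟨ lemma₂ (n ! * (card A ! * b !)) (card A) (suc b) ⟩
      c + d * 1                                            ∎
    where
    t = count (≺? (A ∘ punchIn z) (B ∘ punchIn z))
    ih : t * (card A + b) ! ≡ n ! * (card A ! * b !)
    ih = subst₂ (λ x y → t * (x + y) ! ≡ n ! * (x ! * y !)) (sym a≡) (suc-injective (trans (sym b≡′) b≡))
                (count-≺ (A ∘ punchIn z) (B ∘ punchIn z) (λ u → A#B (punchIn z u)))
    lemma₁ : ∀ t s f c → t * (s * f) + c * 0 ≡ t * f * s
    lemma₁ = solve-∀
    lemma₂ : ∀ m a s → m * (a + s) ≡ m * s + m * a * 1
    lemma₂ = solve-∀
  ... | no z∉A | no _ | a≡ | b≡′ = begin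
      term z * F + c * 0                      ≡⟨ cong (λ t → t * F + c * 0) (count-last-∉ A B z z∉A) ⟩
      t * F + c * 0                           ≡⟨ cong (_+ c * 0) ih ⟩
      n ! * (card A ! * (suc b) !) + c * 0    ≡⟨ lemma (n !) (card A !) (b !) (suc b) (card A) ⟩
      c + d * 0                               ∎
    where
    t = count (≺? (A ∘ punchIn z) (B ∘ punchIn z))
    ih : t * F ≡ n ! * (card A ! * (suc b) !)
    ih = subst₂ (λ x y → t * (x + y) ! ≡ n ! * (x ! * y !)) (sym a≡) (trans (sym b≡′) b≡)
                (count-≺ (A ∘ punchIn z) (B ∘ punchIn z) (λ u → A#B (punchIn z u)))
    lemma : ∀ f x y s a → f * (x * (s * y)) + f * (x * y) * s * 0 ≡ f * (x * y) * s + f * (x * y) * a * 0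
    lemma = solve-∀

-- Read off from the symmetry of the formula in `count-≺`; this stands in for reversing all orders.
count-≺-sym : ∀ (A B : FinSet n) → Disjoint A B → count (≺? A B) ≡ count (≺? B A)
count-≺-sym {n} A B A#B = *-cancelʳ-≡ _ _ ((card A + card B) !) {{(card A + card B) !≢0}} (begin
  count (≺? A B) * (card A + card B) !  ≡⟨ count-≺ A B A#B ⟩
  n ! * (card A ! * card B !)           ≡⟨ cong (n ! *_) (*-comm (card A !) (card B !)) ⟩
  n ! * (card B ! * card A !)           ≡⟨ sym (count-≺ B A λ u p q → A#B u q p) ⟩
  count (≺? B A) * (card B + card A) !  ≡⟨ cong (λ k → count (≺? B A) * k !) (+-comm (card B) (card A)) ⟩
  count (≺? B A) * (card A + card B) !  ∎)
  where open ≡-Reasoning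

-- Symmetry under transpositions

transpose-self : ∀ (A : FinSet n) u v w → A u ≡ A v → A (Components.transpose u v w) ≡ A w
transpose-self A u v w Au≡Av with w ≟ u
... | yes refl = sym Au≡Av
... | no _ with w ≟ v
...   | yes refl = Au≡Av
...   | no _     = refl

transpose-left : ∀ (u v : Fin n) → Components.transpose u v u ≡ v
transpose-left u v with u ≟ u
... | yes _   = refl
... | no u≢u = contradiction refl u≢u

transpose-right : ∀ (u v : Fin n) → Components.transpose u v v ≡ u
transpose-right u v with v ≟ u
... | yes v≡u = v≡u
... | no _ with v ≟ v
...   | yes _   = refl
...   | no v≢v = contradiction refl v≢v

transpose-fixed : ∀ {u v w : Fin n} → w ≢ u → w ≢ v → Components.transpose u v w ≡ w
transpose-fixed {u = u} {v} {w} w≢u w≢v with w ≟ u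
... | yes w≡u = contradiction w≡u w≢u
... | no _ with w ≟ v
...   | yes w≡v = contradiction w≡v w≢v
...   | no _    = refl

rank-transpose : ∀ (u v : Fin n) o w → rank (act (transpose u v) o) (Components.transpose u v w) ≡ rank o w
rank-transpose u v = rank-act (transpose u v)

module _ {R : Order n → Set} (R? : Decidable R) {u v : Fin n} (u≢v : u ≢ v) where

  -- Since `R` is invariant under exchanging `u` and `v`, the exchange matches the orders in `R`
  -- that have `u` first with those that have `v` first.
  count-half : (∀ {o} → R o → R (act (transpose u v) o)) → (∀ {o} → R (act (transpose u v) o) → R o) →
    2 * count (λ o → R? o ×-dec before? u v o) ≡ count R?
  count-half to from = begin
    2 * uv                                                 ≡⟨ cong (λ k → uv + k) (+-identityʳ uv) ⟩
    uv + uv                                                ≡⟨ cong (λ k → uv + k) (sym (∑ₒ-act (transpose u v) _)) ⟩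
    uv + count (λ o → uv? (act (transpose u v) o))         ≡⟨ cong (λ k → uv + k) (count-cong (λ o → uv? (act (transpose u v) o)) vu? swap⁺ swap⁻) ⟩
    uv + count vu?                                         ≡⟨ sym (count-split R? (before? u v)) ⟩
    count R?                                               ∎
    where
    open ≡-Reasoning
    uv? : Decidable (λ o → R o × (u before v) o)
    uv? o = R? o ×-dec before? u v o
    vu? : Decidable (λ o → R o × ¬ (u before v) o)
    vu? o = R? o ×-dec ¬? (before? u v o)
    uv = count uv?
    rank-u : ∀ o → rank (act (transpose u v) o) u ≡ rank o v
    rank-u o = trans (cong (rank (act (transpose u v) o)) (sym (transpose-right u v))) (rank-transpose u v o v)
    rank-v : ∀ o → rank (act (transpose u v) o) v ≡ rank o u
    rank-v o = trans (cong (rank (act (transpose u v) o)) (sym (transpose-left u v))) (rank-transpose u v o u)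
    swap⁺ : ∀ {o} → R (act (transpose u v) o) × (u before v) (act (transpose u v) o) → R o × ¬ (u before v) o
    swap⁺ {o} (r , u<v) = from r , <-asym (subst₂ _<_ (rank-u o) (rank-v o) u<v)
    swap⁻ : ∀ {o} → R o × ¬ (u before v) o → R (act (transpose u v) o) × (u before v) (act (transpose u v) o)
    swap⁻ {o} (r , u≮v) = to r , subst₂ _<_ (sym (rank-u o)) (sym (rank-v o))
                                         (≤∧≢⇒< (≮⇒≥ u≮v) λ eq → u≢v (sym (rank-injective o eq)))

≺-transpose⁺ : ∀ (A B : FinSet n) u v → A u ≡ A v → B u ≡ B v → ∀ {o} → (A ≺ B) o → (A ≺ B) (act (transpose u v) o)
≺-transpose⁺ A B u v Au≡Av Bu≡Bv {o} A≺B x y x∈A y∈B =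
  subst₂ _<_ (lemma x) (lemma y)
    (A≺B _ _ (trans (transpose-self A v u x (sym Au≡Av)) x∈A) (trans (transpose-self B v u y (sym Bu≡Bv)) y∈B))
  where
  lemma : ∀ w → rank o (Components.transpose v u w) ≡ rank (act (transpose u v) o) w
  lemma w = trans (sym (rank-transpose u v o (Components.transpose v u w)))
                  (cong (rank (act (transpose u v) o)) (Components.transpose-inverse u v))

≺-transpose⁻ : ∀ (A B : FinSet n) u v → A u ≡ A v → B u ≡ B v → ∀ {o} → (A ≺ B) (act (transpose u v) o) → (A ≺ B) o
≺-transpose⁻ A B u v Au≡Av Bu≡Bv {o} A≺B x y x∈A y∈B =
  subst₂ _<_ (rank-transpose u v o x) (rank-transpose u v o y)
    (A≺B _ _ (trans (transpose-self A u v x Au≡Av) x∈A) (trans (transpose-self B u v y Bu≡Bv) y∈B))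

∉⇒false : ∀ (A : FinSet n) {z} → ¬ z ∈ A → A z ≡ false
∉⇒false A {z} z∉A with A z
... | true  = contradiction refl z∉A
... | false = refl

module _ (A B : FinSet n) (A#B : Disjoint A B) where

  private
    both∉A : ∀ {u v} → u ∈ B → v ∈ B → A u ≡ A v
    both∉A u∈B v∈B = trans (∉⇒false A λ u∈A → A#B _ u∈A u∈B) (sym (∉⇒false A λ v∈A → A#B _ v∈A v∈B))

    both∉B : ∀ {u v} → u ∈ A → v ∈ A → B u ≡ B v
    both∉B u∈A v∈A = trans (∉⇒false B (A#B _ u∈A)) (sym (∉⇒false B (A#B _ v∈A)))

  count-half-A : ∀ {u v} → u ≢ v → u ∈ A → v ∈ A → 2 * count (λ o → ≺? A B o ×-dec before? u v o) ≡ count (≺? A B)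
  count-half-A {u} {v} u≢v u∈A v∈A = count-half (≺? A B) u≢v
    (≺-transpose⁺ A B u v (trans u∈A (sym v∈A)) (both∉B u∈A v∈A))
    (≺-transpose⁻ A B u v (trans u∈A (sym v∈A)) (both∉B u∈A v∈A))

  count-half-B : ∀ {u v} → u ≢ v → u ∈ B → v ∈ B → 2 * count (λ o → ≺? A B o ×-dec before? u v o) ≡ count (≺? A B)
  count-half-B {u} {v} u≢v u∈B v∈B = count-half (≺? A B) u≢v
    (≺-transpose⁺ A B u v (both∉A u∈B v∈B) (trans u∈B (sym v∈B)))
    (≺-transpose⁻ A B u v (both∉A u∈B v∈B) (trans u∈B (sym v∈B)))

  -- Halving twice: exchanging `u` and `v` in `B` fixes `s` and `t`, which lie in `A`, so the event
  -- that `s` precedes `t` is invariant under the second exchange.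
  count-quarter : ∀ {s t u v} → s ≢ t → s ∈ A → t ∈ A → u ≢ v → u ∈ B → v ∈ B →
    4 * count (λ o → (≺? A B o ×-dec before? s t o) ×-dec before? u v o) ≡ count (≺? A B)
  count-quarter {s} {t} {u} {v} s≢t s∈A t∈A u≢v u∈B v∈B = begin
    4 * k                                                ≡⟨ *-assoc 2 2 k ⟩
    2 * (2 * k)                                          ≡⟨ cong (2 *_) (count-half (λ o → ≺? A B o ×-dec before? s t o) u≢v to from) ⟩
    2 * count (λ o → ≺? A B o ×-dec before? s t o)       ≡⟨ count-half-A s≢t s∈A t∈A ⟩
    count (≺? A B)                                       ∎
    where
    open ≡-Reasoning
    k = count (λ o → (≺? A B o ×-dec before? s t o) ×-dec before? u v o)
    fixed : ∀ {w} → w ∈ A → ∀ o → rank (act (transpose u v) o) w ≡ rank o w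
    fixed {w} w∈A o = trans (cong (rank (act (transpose u v) o)) (sym (transpose-fixed
                               (λ { refl → A#B w w∈A u∈B }) (λ { refl → A#B w w∈A v∈B }))))
                            (rank-transpose u v o w)
    to : ∀ {o} → (A ≺ B) o × (s before t) o → (A ≺ B) (act (transpose u v) o) × (s before t) (act (transpose u v) o)
    to {o} (A≺B , s<t) = ≺-transpose⁺ A B u v (both∉A u∈B v∈B) (trans u∈B (sym v∈B)) A≺B
                       , subst₂ _<_ (sym (fixed s∈A o)) (sym (fixed t∈A o)) s<t
    from : ∀ {o} → (A ≺ B) (act (transpose u v) o) × (s before t) (act (transpose u v) o) → (A ≺ B) o × (s before t) o
    from {o} (A≺B , s<t) = ≺-transpose⁻ A B u v (both∉A u∈B v∈B) (trans u∈B (sym v∈B)) A≺B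
                         , subst₂ _<_ (fixed s∈A o) (fixed t∈A o) s<t

-- Bollobás' inequality

count-guard : (p : Dec P) {R : Order n → Set} (R? : Decidable R) → ι p * count R? ≡ count (λ o → p ×-dec R? o)
count-guard (yes p) R? = trans (*-identityˡ _) (count-cong R? (λ o → yes p ×-dec R? o) (p ,_) proj₂)
count-guard (no ¬p) R? = sym (count-none (λ o → no ¬p ×-dec R? o) (¬p ∘ proj₁))

module _ (active : FinSet m) (A B : Fin m → FinSet n) where

  -- Pairs are switched off through `active` instead of being removed, so that subsystems keep the
  -- index type `Fin m`.
  covered : {R : Order n → Set} → Decidable R → ℕ
  covered R? = sum λ j → ι (j ∈? active) * count (λ o → ≺? (A j) (B j) o ×-dec R? o)

  total : ℕ
  total = sum λ j → ι (j ∈? active) * count (≺? (A j) (B j))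

  total-split : {R : Order n → Set} (R? : Decidable R) → total ≡ covered R? + covered (¬? ∘ R?)
  total-split R? = trans (sum-cong-≗ λ j → trans (cong (ι (j ∈? active) *_) (count-split (≺? (A j) (B j)) R?))
                                                  (*-distribˡ-+ (ι (j ∈? active)) (hit j) (miss j)))
                         (∑-distrib-+ (λ j → ι (j ∈? active) * hit j) (λ j → ι (j ∈? active) * miss j))
    where
    hit miss : Fin m → ℕ
    hit  j = count λ o → ≺? (A j) (B j) o ×-dec R? o
    miss j = count λ o → ≺? (A j) (B j) o ×-dec ¬? (R? o)

  module Intersecting (disjoint : ∀ j → Disjoint (A j) (B j))
                      (meet : ∀ {i j} → i ∈ active → j ∈ active → i ≢ j → ∃ λ z → z ∈ A i × z ∈ B j) where

    -- A point `u` of Aᵢ ∩ Bⱼ and a point `v` of Aⱼ ∩ Bᵢ would each have to precede the other.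
    ≺-unique : ∀ {o i j} → i ∈ active → j ∈ active → (A i ≺ B i) o → (A j ≺ B j) o → i ≡ j
    ≺-unique {o} {i} {j} i-act j-act Aᵢ≺Bᵢ Aⱼ≺Bⱼ with i ≟ j
    ... | yes i≡j = i≡j
    ... | no i≢j with meet i-act j-act i≢j | meet j-act i-act (i≢j ∘ sym)
    ...   | u , u∈Aᵢ , u∈Bⱼ | v , v∈Aⱼ , v∈Bᵢ =
      contradiction (Aⱼ≺Bⱼ v u v∈Aⱼ u∈Bⱼ) (<-asym (Aᵢ≺Bᵢ u v u∈Aᵢ v∈Bᵢ))

    -- Double counting: with the sums exchanged, `≺-unique` lets each order in `R` count at most
    -- once. For the event that always holds this is Bollobás' bound.
    covered≤count : {R : Order n → Set} (R? : Decidable R) → covered R? ≤ count R?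
    covered≤count {R} R? = begin
      covered R?                                ≡⟨ sum-cong-≗ (λ j → count-guard (j ∈? active) (λ o → ≺? (A j) (B j) o ×-dec R? o)) ⟩
      sum (λ j → count (λ o → T? o j))          ≡⟨ ∑ₒ-comm-sum (λ j o → ι (T? o j)) ⟩
      ∑ₒ (λ o → sum (λ j → ι (T? o j)))         ≤⟨ ∑ₒ-mono _ _ pointwise ⟩
      count R?                                  ∎
      where
      open ≤-Reasoning
      T? : ∀ o → Decidable (λ j → j ∈ active × ((A j ≺ B j) o × R o))
      T? o j = (j ∈? active) ×-dec (≺? (A j) (B j) o ×-dec R? o)
      pointwise : ∀ o → sum (λ j → ι (T? o j)) ≤ ι (R? o)
      pointwise o with R? o in eq
      ... | yes r rewrite sym eq = sum-disjoint (T? o) λ (i-act , Aᵢ≺Bᵢ , _) (j-act , Aⱼ≺Bⱼ , _) → ≺-unique i-act j-act Aᵢ≺Bᵢ Aⱼ≺Bⱼ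
      ... | no ¬r rewrite sym eq = ≤-reflexive (sum-zero λ j → ι-false (λ (_ , _ , r) → ¬r r) (T? o j))

    -- Outside `R` each order is separated at most once, so the total stays below n! by at least the
    -- number of unseparated orders in `R`. Stated additively to avoid truncated subtraction.
    total+count≤covered+n! : {R : Order n → Set} (R? : Decidable R) → total + count R? ≤ covered R? + n !
    total+count≤covered+n! R? = begin
      total + count R?                                          ≡⟨ cong (_+ count R?) (total-split R?) ⟩
      covered R? + covered (¬? ∘ R?) + count R?                 ≡⟨ +-assoc (covered R?) _ _ ⟩
      covered R? + (covered (¬? ∘ R?) + count R?)               ≤⟨ +-monoʳ-≤ (covered R?) (+-monoˡ-≤ (count R?) (covered≤count (¬? ∘ R?))) ⟩
      covered R? + (count (¬? ∘ R?) + count R?)                 ≡⟨ cong (λ k → covered R? + k) (+-comm (count (¬? ∘ R?)) (count R?)) ⟩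
      covered R? + (count R? + count (¬? ∘ R?))                 ≡⟨ cong (λ k → covered R? + k) (sym complement) ⟩
      covered R? + n !                                          ∎
      where
      open ≤-Reasoning
      ⊤? : Decidable {A = Order n} (λ _ → ⊤)
      ⊤? _ = yes tt
      complement : n ! ≡ count R? + count (¬? ∘ R?)
      complement = trans (sym (count-all ⊤? tt)) (trans (count-split ⊤? R?)
        (cong₂ _+_ (count-cong (λ o → ⊤? o ×-dec R? o) R? proj₂ (tt ,_))
                   (count-cong (λ o → ⊤? o ×-dec ¬? (R? o)) (¬? ∘ R?) proj₂ (tt ,_))))

-- Comparison of binomial coefficients

4pq≤[p+q]² : ∀ p q → 4 * (p * q) ≤ (p + q) * (p + q)
4pq≤[p+q]² p q with ≤-total p q
-- With q = p + d the two sides differ by d².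
... | inj₁ p≤q rewrite sym (m+[n∸m]≡n p≤q) = subst (4 * (p * (p + (q ∸ p))) ≤_) (lemma p (q ∸ p)) (m≤m+n _ _)
  where
  lemma : ∀ p d → 4 * (p * (p + d)) + d * d ≡ (p + (p + d)) * (p + (p + d))
  lemma = solve-∀
... | inj₂ q≤p rewrite sym (m+[n∸m]≡n q≤p) = subst (4 * ((q + (p ∸ q)) * q) ≤_) (lemma q (p ∸ q)) (m≤m+n _ _)
  where
  lemma : ∀ q d → 4 * ((q + d) * q) + d * d ≡ (q + d + q) * (q + d + q)
  lemma = solve-∀

-- The quotient (s + 4)! / s!.
rising : ℕ → ℕ
rising s = (4 + s) * ((3 + s) * ((2 + s) * (1 + s)))

-- Equality at a + b = 1 and at a = b = 1.
10pairs≤rising : ∀ a b → a + b ≢ 0 → 10 * ((2 + a) * (1 + a) * ((2 + b) * (1 + b))) ≤ rising (a + b)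
10pairs≤rising a b s≢0 = by-sum (a + b) refl s≢0
  where
  large : ∀ t → a + b ≡ 2 + t → 10 * ((2 + a) * (1 + a) * ((2 + b) * (1 + b))) ≤ rising (2 + t)
  -- The factor 16 makes room for two uses of 4pq ≤ (p + q)², which leave an expression in a + b
  -- alone.
  large t s≡ = *-cancelˡ-≤ 16 (begin
    16 * (10 * ((2 + a) * (1 + a) * ((2 + b) * (1 + b))))                ≡⟨ regroup₁ a b ⟩
    10 * (4 * ((2 + a) * (2 + b)) * (4 * ((1 + a) * (1 + b))))           ≤⟨ *-monoʳ-≤ 10 (*-mono-≤ (4pq≤[p+q]² (2 + a) (2 + b)) (4pq≤[p+q]² (1 + a) (1 + b))) ⟩
    10 * ((2 + a + (2 + b)) * (2 + a + (2 + b)) * ((1 + a + (1 + b)) * (1 + a + (1 + b))))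
                                                                         ≡⟨ regroup₂ a b ⟩
    10 * ((4 + (a + b)) * (4 + (a + b)) * ((2 + (a + b)) * (2 + (a + b)))) ≡⟨ cong (λ s → 10 * ((4 + s) * (4 + s) * ((2 + s) * (2 + s)))) s≡ ⟩
    10 * ((6 + t) * (6 + t) * ((4 + t) * (4 + t)))                       ≤⟨ m≤m+n _ _ ⟩
    -- The added term is the exact slack, from 8(5 + t)(3 + t) - 5(6 + t)(4 + t) = 3t² + 14t.
    10 * ((6 + t) * (6 + t) * ((4 + t) * (4 + t))) + 2 * ((6 + t) * (4 + t)) * (3 * (t * t) + 14 * t)
                                                                         ≡⟨ regroup₃ t ⟩
    16 * rising (2 + t)                                                  ∎)
    where
    open ≤-Reasoning
    regroup₁ : ∀ a b → 16 * (10 * ((2 + a) * (1 + a) * ((2 + b) * (1 + b)))) ≡ 10 * (4 * ((2 + a) * (2 + b)) * (4 * ((1 + a) * (1 + b))))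
    regroup₁ = solve-∀
    regroup₂ : ∀ a b → 10 * ((2 + a + (2 + b)) * (2 + a + (2 + b)) * ((1 + a + (1 + b)) * (1 + a + (1 + b))))
                     ≡ 10 * ((4 + (a + b)) * (4 + (a + b)) * ((2 + (a + b)) * (2 + (a + b))))
    regroup₂ = solve-∀
    regroup₃ : ∀ t → 10 * ((6 + t) * (6 + t) * ((4 + t) * (4 + t))) + 2 * ((6 + t) * (4 + t)) * (3 * (t * t) + 14 * t)
                   ≡ 16 * ((6 + t) * ((5 + t) * ((4 + t) * (3 + t))))
    regroup₃ = solve-∀
  by-sum : ∀ s → a + b ≡ s → s ≢ 0 → 10 * ((2 + a) * (1 + a) * ((2 + b) * (1 + b))) ≤ rising s
  by-sum zero          s≡ s≢0 = contradiction refl s≢0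
  -- For a + b = 1 the estimate by squares is too weak: it would require 2250 ≤ 1920.
  by-sum (suc zero)    s≡ _ = one a b s≡
    where
    one : ∀ a b → a + b ≡ 1 → 10 * ((2 + a) * (1 + a) * ((2 + b) * (1 + b))) ≤ rising 1
    one zero       .1    refl = ≤-refl
    one (suc zero) zero  refl = ≤-refl
  by-sum (suc (suc t)) s≡ _ = large t s≡

module _ (A B A⁺ B⁺ : FinSet n) (A#B : Disjoint A B) (A⁺#B⁺ : Disjoint A⁺ B⁺) where

  -- By `count-≺` the ratio of the two counts is C(a + b + 4, a + 2) / C(a + b, a), with a and b the
  -- sizes of `A` and `B`. Cancelling factorials leaves `10pairs≤rising`.
  10count≤count : card A⁺ ≡ 2 + card A → card B⁺ ≡ 2 + card B → card A + card B ≢ 0 →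
    10 * count (≺? A⁺ B⁺) ≤ count (≺? A B)
  10count≤count a⁺≡ b⁺≡ s≢0 = *-cancelʳ-≤ _ _ (c !) {{c !≢0}} (begin
    10 * count (≺? A⁺ B⁺) * c !                                             ≡⟨ cong (λ k → 10 * count (≺? A⁺ B⁺) * k !) (sym c≡) ⟩
    10 * count (≺? A⁺ B⁺) * (card A⁺ + card B⁺) !                           ≡⟨ *-assoc 10 (count (≺? A⁺ B⁺)) _ ⟩
    10 * (count (≺? A⁺ B⁺) * (card A⁺ + card B⁺) !)                         ≡⟨ cong (10 *_) (count-≺ A⁺ B⁺ A⁺#B⁺) ⟩
    10 * (n ! * (card A⁺ ! * card B⁺ !))                                    ≡⟨ cong₂ (λ x y → 10 * (n ! * (x ! * y !))) a⁺≡ b⁺≡ ⟩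
    10 * (n ! * ((2 + a) * ((1 + a) * a !) * ((2 + b) * ((1 + b) * b !))))  ≡⟨ regroup₁ (n !) (2 + a) (1 + a) (a !) (2 + b) (1 + b) (b !) ⟩
    n ! * (a ! * b !) * (10 * ((2 + a) * (1 + a) * ((2 + b) * (1 + b))))    ≤⟨ *-monoʳ-≤ (n ! * (a ! * b !)) (10pairs≤rising a b s≢0) ⟩
    n ! * (a ! * b !) * rising (a + b)                                      ≡⟨ cong (_* rising (a + b)) (sym (count-≺ A B A#B)) ⟩
    count (≺? A B) * (a + b) ! * rising (a + b)                             ≡⟨ regroup₂ (count (≺? A B)) ((a + b) !) (4 + (a + b)) (3 + (a + b)) (2 + (a + b)) (1 + (a + b)) ⟩
    count (≺? A B) * c !                                                    ∎)
    where
    open ≤-Reasoning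
    a b c : ℕ
    a = card A
    b = card B
    c = 4 + (a + b)
    c≡ : card A⁺ + card B⁺ ≡ c
    c≡ = trans (cong₂ _+_ a⁺≡ b⁺≡) (lemma a b)
      where
      lemma : ∀ a b → 2 + a + (2 + b) ≡ 4 + (a + b)
      lemma = solve-∀
    regroup₁ : ∀ f p q x r s y → 10 * (f * (p * (q * x) * (r * (s * y)))) ≡ f * (x * y) * (10 * (p * q * (r * s)))
    regroup₁ = solve-∀
    regroup₂ : ∀ k f p q r s → k * f * (p * (q * (r * s))) ≡ k * (p * (q * (r * (s * f))))
    regroup₂ = solve-∀

-- Orders in which given points form a chain

∅ : FinSet n
∅ _ = false

∉∅ : ∀ (z : Fin n) → ¬ z ∈ ∅
∉∅ z ()

card-∅ : ∀ n → card {n} ∅ ≡ 0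
card-∅ n = sum-zero {n} λ _ → refl

∈-∅⊹⁻ : ∀ v {u : Fin n} → u ∈ ∅ ⊹ v → u ≡ v
∈-∅⊹⁻ v p with ∈-⊹⁻ ∅ p
... | inj₁ u≡v = u≡v

∈-∅⊹⊹⁻ : ∀ v w {u : Fin n} → u ∈ ∅ ⊹ v ⊹ w → u ≡ w ⊎ u ≡ v
∈-∅⊹⊹⁻ v w p with ∈-⊹⁻ (∅ ⊹ v) p
... | inj₁ u≡w = inj₁ u≡w
... | inj₂ q   = inj₂ (∈-∅⊹⁻ v q)

card-∅⊹ : ∀ (u : Fin n) → card (∅ ⊹ u) ≡ 1
card-∅⊹ {n} u = trans (card-⊹ ∅ {u} (∉∅ u)) (cong suc (card-∅ n))

card-∅⊹⊹ : ∀ {u v : Fin n} → v ≢ u → card (∅ ⊹ u ⊹ v) ≡ 2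
card-∅⊹⊹ {n} {u} {v} v≢u = trans (card-⊹ (∅ ⊹ u) (v≢u ∘ ∈-∅⊹⁻ u)) (cong suc (card-∅⊹ u))

∈-⊹⊹ˡ : ∀ (A : FinSet n) u v → u ∈ A ⊹ u ⊹ v
∈-⊹⊹ˡ A u v = ∈-⊹-old (A ⊹ u) (∈-⊹-new A u)

chain₃? : (u v w : Fin n) → Decidable (λ o → (u before v) o × (v before w) o)
chain₃? u v w o = before? u v o ×-dec before? v w o

-- The point `u` precedes both `v` and `w` with probability 1/3, and half of these orders have `v`
-- before `w`.
n!≤6count-chain₃ : ∀ {u v w : Fin n} → u ≢ v → u ≢ w → v ≢ w → n ! ≤ 6 * count (chain₃? u v w)
n!≤6count-chain₃ {n} {u} {v} {w} u≢v u≢w v≢w = begin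
  n !                                                    ≡⟨ *-cancelʳ-≡ _ _ 2 n!*2≡ ⟩
  3 * count (≺? U VW)                                    ≡⟨ cong (3 *_) (sym (count-half-B U VW U#VW v≢w (∈-⊹⊹ˡ ∅ v w) (∈-⊹-new (∅ ⊹ v) w))) ⟩
  3 * (2 * k)                                            ≡⟨ sym (*-assoc 3 2 k) ⟩
  6 * k                                                  ≤⟨ *-monoʳ-≤ 6 (count-mono (λ o → ≺? U VW o ×-dec before? v w o) (chain₃? u v w)
                                                              λ (U≺VW , v<w) → U≺VW u v (∈-⊹-new ∅ u) (∈-⊹⊹ˡ ∅ v w) , v<w) ⟩
  6 * count (chain₃? u v w)                              ∎
  where
  open ≤-Reasoning
  U VW : FinSet n
  U  = ∅ ⊹ u
  VW = ∅ ⊹ v ⊹ w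
  k  = count (λ o → ≺? U VW o ×-dec before? v w o)
  U#VW : Disjoint U VW
  U#VW z p q with ∈-∅⊹⁻ u {z} p | ∈-∅⊹⊹⁻ v w {z} q
  ... | refl | inj₁ u≡w = u≢w u≡w
  ... | refl | inj₂ u≡v = u≢v u≡v
  n!*2≡ : n ! * 2 ≡ 3 * count (≺? U VW) * 2
  n!*2≡ = trans (sym (subst₂ (λ a b → count (≺? U VW) * (a + b) ! ≡ n ! * (a ! * b !)) (card-∅⊹ u) (card-∅⊹⊹ (v≢w ∘ sym))
                             (count-≺ U VW U#VW)))
                (lemma (count (≺? U VW)))
    where
    lemma : ∀ k → k * 6 ≡ 3 * k * 2
    lemma = solve-∀

chain₄? : (s t u v : Fin n) → Decidable (λ o → (s before t) o × (t before u) o × (u before v) o)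
chain₄? s t u v o = before? s t o ×-dec (before? t u o ×-dec before? u v o)

-- The points `s`, `t` precede `u`, `v` with probability 1/6, and `count-quarter` fixes the order
-- inside both couples.
n!≤24count-chain₄ : ∀ {s t u v : Fin n} → s ≢ t → s ≢ u → s ≢ v → t ≢ u → t ≢ v → u ≢ v → n ! ≤ 24 * count (chain₄? s t u v)
n!≤24count-chain₄ {n} {s} {t} {u} {v} s≢t s≢u s≢v t≢u t≢v u≢v = begin
  n !                           ≡⟨ *-cancelʳ-≡ _ _ 4 n!*4≡ ⟩
  6 * count (≺? ST UV)          ≡⟨ cong (6 *_) (sym (count-quarter ST UV ST#UV s≢t (∈-⊹⊹ˡ ∅ s t) (∈-⊹-new (∅ ⊹ s) t)
                                                                           u≢v (∈-⊹⊹ˡ ∅ u v) (∈-⊹-new (∅ ⊹ u) v))) ⟩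
  6 * (4 * k)                   ≡⟨ sym (*-assoc 6 4 k) ⟩
  24 * k                        ≤⟨ *-monoʳ-≤ 24 (count-mono (λ o → (≺? ST UV o ×-dec before? s t o) ×-dec before? u v o) (chain₄? s t u v)
                                     λ ((ST≺UV , s<t) , u<v) → s<t , ST≺UV t u (∈-⊹-new (∅ ⊹ s) t) (∈-⊹⊹ˡ ∅ u v) , u<v) ⟩
  24 * count (chain₄? s t u v)  ∎
  where
  open ≤-Reasoning
  ST UV : FinSet n
  ST = ∅ ⊹ s ⊹ t
  UV = ∅ ⊹ u ⊹ v
  k  = count (λ o → (≺? ST UV o ×-dec before? s t o) ×-dec before? u v o)
  ST#UV : Disjoint ST UV
  ST#UV z p q with ∈-∅⊹⊹⁻ s t {z} p | ∈-∅⊹⊹⁻ u v {z} q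
  ... | inj₁ refl | inj₁ t≡v = t≢v t≡v
  ... | inj₁ refl | inj₂ t≡u = t≢u t≡u
  ... | inj₂ refl | inj₁ s≡v = s≢v s≡v
  ... | inj₂ refl | inj₂ s≡u = s≢u s≡u
  n!*4≡ : n ! * 4 ≡ 6 * count (≺? ST UV) * 4
  n!*4≡ = trans (sym (subst₂ (λ a b → count (≺? ST UV) * (a + b) ! ≡ n ! * (a ! * b !)) (card-∅⊹⊹ (s≢t ∘ sym)) (card-∅⊹⊹ (u≢v ∘ sym))
                             (count-≺ ST UV ST#UV)))
                (lemma (count (≺? ST UV)))
    where
    lemma : ∀ k → k * 24 ≡ 6 * k * 4
    lemma = solve-∀

-- With |B| = 2 the probability is 2 / ((a + 1)(a + 2)), which is at most 2 / (4 · 5) for a ≥ 3.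
10count≤n! : ∀ (A B : FinSet n) → Disjoint A B → 3 ≤ card A → card B ≡ 2 → 10 * count (≺? A B) ≤ n !
10count≤n! {n} A B A#B 3≤a b≡2 = *-cancelˡ-≤ 2 (*-cancelʳ-≤ _ _ (a !) {{a !≢0}} (begin
  2 * (10 * k) * a !                    ≡⟨ cong (_* a !) (regroup₁ k) ⟩
  k * 20 * a !                          ≤⟨ *-monoˡ-≤ (a !) (*-monoʳ-≤ k (*-mono-≤ (+-monoʳ-≤ 2 3≤a) (+-monoʳ-≤ 1 3≤a))) ⟩
  k * ((2 + a) * (1 + a)) * a !         ≡⟨ regroup₂ k (2 + a) (1 + a) (a !) ⟩
  k * (2 + a) !                         ≡⟨ cong (λ s → k * s !) (+-comm 2 a) ⟩
  k * (a + 2) !                         ≡⟨ subst (λ b → k * (a + b) ! ≡ n ! * (a ! * b !)) b≡2 (count-≺ A B A#B) ⟩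
  n ! * (a ! * 2)                       ≡⟨ regroup₃ (n !) (a !) ⟩
  2 * n ! * a !                         ∎))
  where
  open ≤-Reasoning
  a k : ℕ
  a = card A
  k = count (≺? A B)
  regroup₁ : ∀ k → 2 * (10 * k) ≡ k * 20
  regroup₁ = solve-∀
  regroup₂ : ∀ k p q f → k * (p * q) * f ≡ k * (p * (q * f))
  regroup₂ = solve-∀
  regroup₃ : ∀ f g → f * (g * 2) ≡ 2 * f * g
  regroup₃ = solve-∀

-- A pair of sizes 2 and 2

-- The hypotheses in a form fit for induction: the sizes themselves replace their upper bounds, and
-- the size and intersection conditions concern active pairs only.
record CrossSystem (m n : ℕ) : Set where
  field
    active   : FinSet m
    A B      : Fin m → FinSet n
    disjoint : ∀ j → Disjoint (A j) (B j)
    cross    : ∀ {i j} → i ∈ active → j ∈ active → i ≢ j → card (A i ∩ᶠ B j) ≡ 1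
    2≤A      : ∀ {j} → j ∈ active → 2 ≤ card (A j)
    2≤B      : ∀ {j} → j ∈ active → 2 ≤ card (B j)

  meet : ∀ {i j} → i ∈ active → j ∈ active → i ≢ j → ∃ λ z → z ∈ A i × z ∈ B j
  meet {i} {j} i-act j-act i≢j with card>0⇒∃ (A i ∩ᶠ B j) (≤-reflexive (sym (cross i-act j-act i≢j)))
  ... | z , z∈ = z , ∈-∩⁻ (A i) (B j) z∈

  meet-unique : ∀ {i j u v} → i ∈ active → j ∈ active → i ≢ j → u ∈ A i → u ∈ B j → v ∈ A i → v ∈ B j → u ≡ v
  meet-unique {i} {j} i-act j-act i≢j u∈A u∈B v∈A v∈B =
    card≡1⇒unique (A i ∩ᶠ B j) (cross i-act j-act i≢j) (∈-∩⁺ (A i) (B j) u∈A u∈B) (∈-∩⁺ (A i) (B j) v∈A v∈B)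

  open Intersecting active A B disjoint meet public

  Total : ℕ
  Total = total active A B

  Covered : {R : Order n → Set} → Decidable R → ℕ
  Covered = covered active A B

module Pair (S : CrossSystem m n) where
  open CrossSystem S

  -- Names the points of a pair of sizes 2 and 2; `swapA` and `swapB` then give the four choices of
  -- (x, y).
  record Square (i : Fin m) (x x′ y y′ : Fin n) : Set where
    field
      i-act       : i ∈ active
      x∈Aᵢ        : x ∈ A i
      x′∈Aᵢ       : x′ ∈ A i
      y∈Bᵢ        : y ∈ B i
      y′∈Bᵢ       : y′ ∈ B i
      x≢x′        : x ≢ x′
      y≢y′        : y ≢ y′
      Aᵢ-only     : ∀ {w} → w ∈ A i → w ≡ x ⊎ w ≡ x′
      Bᵢ-only     : ∀ {w} → w ∈ B i → w ≡ y ⊎ w ≡ y′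

    ≢-AB : ∀ {u v} → u ∈ A i → v ∈ B i → u ≢ v
    ≢-AB u∈A v∈B refl = disjoint i _ u∈A v∈B

  swapA : ∀ {i x x′ y y′} → Square i x x′ y y′ → Square i x′ x y y′
  swapA sq = record
    { i-act = i-act ; x∈Aᵢ = x′∈Aᵢ ; x′∈Aᵢ = x∈Aᵢ ; y∈Bᵢ = y∈Bᵢ ; y′∈Bᵢ = y′∈Bᵢ
    ; x≢x′ = x≢x′ ∘ sym ; y≢y′ = y≢y′ ; Aᵢ-only = swap ∘ Aᵢ-only ; Bᵢ-only = Bᵢ-only }
    where open Square sq

  swapB : ∀ {i x x′ y y′} → Square i x x′ y y′ → Square i x x′ y′ y
  swapB sq = record
    { i-act = i-act ; x∈Aᵢ = x∈Aᵢ ; x′∈Aᵢ = x′∈Aᵢ ; y∈Bᵢ = y′∈Bᵢ ; y′∈Bᵢ = y∈Bᵢ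
    ; x≢x′ = x≢x′ ; y≢y′ = y≢y′ ∘ sym ; Aᵢ-only = Aᵢ-only ; Bᵢ-only = swap ∘ Bᵢ-only }
    where open Square sq

  -- As active sets have at least two points, this forces the pair to be ({y, x′}, {x, y′}), the
  -- exception for the chain x′ < y < x < y′. It is phrased by the sizes after deletion because
  -- `10count≤count` needs their sum to be nonzero.
  Tight : (x x′ y y′ : Fin n) → Fin m → Set
  Tight x x′ y y′ j = j ∈ active × y ∈ A j × x ∈ B j × card (A j ─ y ─ x′) + card (B j ─ x ─ y′) ≡ 0

  tight? : ∀ x x′ y y′ → Decidable (Tight x x′ y y′)
  tight? x x′ y y′ j = (j ∈? active) ×-dec ((y ∈? A j) ×-dec ((x ∈? B j) ×-dec (card (A j ─ y ─ x′) + card (B j ─ x ─ y′) ℕ.≟ 0)))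

  private
    second : ∀ (Z : FinSet n) {u v} → 2 ≤ card Z → u ∈ Z → card (Z ─ u ─ v) ≡ 0 → v ∈ Z
    second Z {u} {v} 2≤c u∈Z c′≡0 with card>0⇒∃ (Z ─ u) (≤-pred (subst (2 ≤_) (card-─ Z u∈Z) 2≤c))
    ... | w , w∈Z′ with w ≟ v
    ...   | yes refl = proj₁ (∈-─⁻ Z w∈Z′)
    ...   | no w≢v   = contradiction c′≡0 (>⇒≢ (∈⇒card>0 (Z ─ u ─ v) (∈-─⁺ (Z ─ u) w∈Z′ w≢v)))

  tight⇒∈ : ∀ {x x′ y y′ j} → Tight x x′ y y′ j → x′ ∈ A j × y′ ∈ B j
  tight⇒∈ {x} {x′} {y} {y′} {j} (j-act , y∈Aⱼ , x∈Bⱼ , s≡0) =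
      second (A j) (2≤A j-act) y∈Aⱼ (m+n≡0⇒m≡0 _ s≡0)
    , second (B j) (2≤B j-act) x∈Bⱼ (m+n≡0⇒n≡0 (card (A j ─ y ─ x′)) s≡0)

  -- Otherwise Aⱼ ∩ Bₖ would contain both `x′` and `y`, which differ since one is in Aᵢ and the
  -- other in Bᵢ. Here j ≠ k because `y` lies in Aⱼ and in Bₖ.
  tight-opposite : ∀ {i x x′ y y′ j k} → Square i x x′ y y′ → Tight x x′ y y′ j → ¬ Tight x′ x y′ y k
  tight-opposite {j = j} sq tⱼ@(j-act , y∈Aⱼ , _) tₖ@(k-act , y′∈Aₖ , x′∈Bₖ , _) =
    ≢-AB x′∈Aᵢ y∈Bᵢ (meet-unique j-act k-act (λ { refl → disjoint j _ y∈Aⱼ y∈Bₖ }) (proj₁ (tight⇒∈ tⱼ)) x′∈Bₖ y∈Aⱼ y∈Bₖ)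
    where
    open Square sq
    y∈Bₖ = proj₂ (tight⇒∈ tₖ)

  module Chain {i x x′ y y′} (sq : Square i x x′ y y′) (loose : ∀ j → ¬ Tight x x′ y y′ j) where
    open Square sq

    A′ B′ : Fin m → FinSet n
    A′ j = A j ─ y ─ x′
    B′ j = B j ─ x ─ y′

    A′⊆A : ∀ {j w} → w ∈ A′ j → w ∈ A j
    A′⊆A {j} = proj₁ ∘ ∈-─⁻ (A j) ∘ proj₁ ∘ ∈-─⁻ (A j ─ y)

    B′⊆B : ∀ {j w} → w ∈ B′ j → w ∈ B j
    B′⊆B {j} = proj₁ ∘ ∈-─⁻ (B j) ∘ proj₁ ∘ ∈-─⁻ (B j ─ x)

    A′#B′ : ∀ j → Disjoint (A′ j) (B′ j)
    A′#B′ j w w∈A′ w∈B′ = disjoint j w (A′⊆A w∈A′) (B′⊆B w∈B′)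

    module Member {j} (j-act : j ∈ active) (y∈Aⱼ : y ∈ A j) (x∈Bⱼ : x ∈ B j) where

      i≢j : i ≢ j
      i≢j refl = disjoint i y y∈Aⱼ y∈Bᵢ

      -- The single point of Aⱼ ∩ Bᵢ is already `y`.
      y′∉Aⱼ : ¬ y′ ∈ A j
      y′∉Aⱼ y′∈Aⱼ = y≢y′ (meet-unique j-act i-act (i≢j ∘ sym) y∈Aⱼ y∈Bᵢ y′∈Aⱼ y′∈Bᵢ)

      x′∉Bⱼ : ¬ x′ ∈ B j
      x′∉Bⱼ x′∈Bⱼ = x≢x′ (meet-unique i-act j-act i≢j x∈Aᵢ x∈Bⱼ x′∈Aᵢ x′∈Bⱼ)

      -- It is open whether `x′` lies in `A j` and `y′` in `B j`. Deleting and reinserting yields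
      -- sets that do contain them and have exactly two points more than `A′ j` and `B′ j`.
      A⁺ B⁺ : FinSet n
      A⁺ = A′ j ⊹ y ⊹ x′
      B⁺ = B′ j ⊹ x ⊹ y′

      A⁺-cases : ∀ {w} → w ∈ A⁺ → w ≡ x′ ⊎ w ∈ A j
      A⁺-cases w∈ with ∈-⊹⁻ (A′ j ⊹ y) w∈
      ... | inj₁ w≡x′ = inj₁ w≡x′
      ... | inj₂ w∈′ with ∈-⊹⁻ (A′ j) w∈′
      ...   | inj₁ refl  = inj₂ y∈Aⱼ
      ...   | inj₂ w∈A′ = inj₂ (A′⊆A w∈A′)

      B⁺-cases : ∀ {w} → w ∈ B⁺ → w ≡ y′ ⊎ w ∈ B j
      B⁺-cases w∈ with ∈-⊹⁻ (B′ j ⊹ x) w∈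
      ... | inj₁ w≡y′ = inj₁ w≡y′
      ... | inj₂ w∈′ with ∈-⊹⁻ (B′ j) w∈′
      ...   | inj₁ refl  = inj₂ x∈Bⱼ
      ...   | inj₂ w∈B′ = inj₂ (B′⊆B w∈B′)

      A⁺#B⁺ : Disjoint A⁺ B⁺
      A⁺#B⁺ w p q with A⁺-cases p | B⁺-cases q
      ... | inj₁ refl | inj₁ x′≡y′ = ≢-AB x′∈Aᵢ y′∈Bᵢ x′≡y′
      ... | inj₁ refl | inj₂ x′∈Bⱼ = x′∉Bⱼ x′∈Bⱼ
      ... | inj₂ y′∈Aⱼ | inj₁ refl = y′∉Aⱼ y′∈Aⱼ
      ... | inj₂ w∈Aⱼ | inj₂ w∈Bⱼ = disjoint j w w∈Aⱼ w∈Bⱼ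

      card-A⁺ : card A⁺ ≡ 2 + card (A′ j)
      card-A⁺ = trans (card-⊹ (A′ j ⊹ y) x′∉) (cong suc (card-⊹ (A′ j) λ p → proj₂ (∈-─⁻ (A j) (proj₁ (∈-─⁻ (A j ─ y) p))) refl))
        where
        x′∉ : ¬ x′ ∈ A′ j ⊹ y
        x′∉ p with ∈-⊹⁻ (A′ j) p
        ... | inj₁ x′≡y = ≢-AB x′∈Aᵢ y∈Bᵢ x′≡y
        ... | inj₂ q     = proj₂ (∈-─⁻ (A j ─ y) q) refl

      card-B⁺ : card B⁺ ≡ 2 + card (B′ j)
      card-B⁺ = trans (card-⊹ (B′ j ⊹ x) y′∉) (cong suc (card-⊹ (B′ j) λ p → proj₂ (∈-─⁻ (B j) (proj₁ (∈-─⁻ (B j ─ x) p))) refl))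
        where
        y′∉ : ¬ y′ ∈ B′ j ⊹ x
        y′∉ p with ∈-⊹⁻ (B′ j) p
        ... | inj₁ y′≡x = ≢-AB x∈Aᵢ y′∈Bᵢ (sym y′≡x)
        ... | inj₂ q     = proj₂ (∈-─⁻ (B j ─ x) q) refl

      -- On the chain, `x′` precedes `y` in `A j` and `y′` follows `x` in `B j`, so `A⁺` precedes
      -- `B⁺` as well. The relations x′ < y and x < y′ inside these sets give a factor 4, and the
      -- deletion gives a factor 10.
      40count≤count : 40 * count (λ o → ≺? (A j) (B j) o ×-dec chain₄? x′ y x y′ o) ≤ count (≺? (A′ j) (B′ j))
      40count≤count = begin
        40 * count (λ o → ≺? (A j) (B j) o ×-dec chain₄? x′ y x y′ o)
          ≤⟨ *-monoʳ-≤ 40 (count-mono (λ o → ≺? (A j) (B j) o ×-dec chain₄? x′ y x y′ o) (λ o → (≺? A⁺ B⁺ o ×-dec before? x′ y o) ×-dec before? x y′ o) extend) ⟩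
        40 * k
          ≡⟨ *-assoc 10 4 k ⟩
        10 * (4 * k)
          ≡⟨ cong (10 *_) (count-quarter A⁺ B⁺ A⁺#B⁺ (≢-AB x′∈Aᵢ y∈Bᵢ) (∈-⊹-new (A′ j ⊹ y) x′) (∈-⊹⊹ˡ (A′ j) y x′)
                                         (≢-AB x∈Aᵢ y′∈Bᵢ) (∈-⊹⊹ˡ (B′ j) x y′) (∈-⊹-new (B′ j ⊹ x) y′)) ⟩
        10 * count (≺? A⁺ B⁺)
          ≤⟨ 10count≤count (A′ j) (B′ j) A⁺ B⁺ (A′#B′ j) A⁺#B⁺ card-A⁺ card-B⁺ (λ s≡0 → loose j (j-act , y∈Aⱼ , x∈Bⱼ , s≡0)) ⟩
        count (≺? (A′ j) (B′ j)) ∎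
        where
        open ≤-Reasoning
        k = count (λ o → (≺? A⁺ B⁺ o ×-dec before? x′ y o) ×-dec before? x y′ o)
        extend : ∀ {o} → (A j ≺ B j) o × (x′ before y) o × (y before x) o × (x before y′) o →
                 ((A⁺ ≺ B⁺) o × (x′ before y) o) × (x before y′) o
        extend {o} (A≺B , x′<y , y<x , x<y′) = (A⁺≺B⁺ , x′<y) , x<y′
          where
          A⁺≺B⁺ : (A⁺ ≺ B⁺) o
          A⁺≺B⁺ u v u∈ v∈ with A⁺-cases u∈ | B⁺-cases v∈
          ... | inj₁ refl | inj₁ refl = <-trans x′<y (<-trans y<x x<y′)
          ... | inj₁ refl | inj₂ v∈Bⱼ = <-trans x′<y (A≺B y v y∈Aⱼ v∈Bⱼ)
          ... | inj₂ u∈Aⱼ | inj₁ refl = <-trans (A≺B u x u∈Aⱼ x∈Bⱼ) x<y′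
          ... | inj₂ u∈Aⱼ | inj₂ v∈Bⱼ = A≺B u v u∈Aⱼ v∈Bⱼ

    member : FinSet m
    member = active ∩ᶠ ((λ j → A j y) ∩ᶠ (λ j → B j x))

    member⁺ : ∀ {j} → j ∈ active → y ∈ A j → x ∈ B j → j ∈ member
    member⁺ {j} j-act y∈Aⱼ x∈Bⱼ = ∈-∩⁺ active ((λ j → A j y) ∩ᶠ (λ j → B j x)) {j} j-act (∈-∩⁺ (λ j → A j y) (λ j → B j x) {j} y∈Aⱼ x∈Bⱼ)

    member⁻ : ∀ {j} → j ∈ member → j ∈ active × y ∈ A j × x ∈ B j
    member⁻ {j} p with ∈-∩⁻ active ((λ j → A j y) ∩ᶠ (λ j → B j x)) {j} p
    ... | j-act , q = j-act , ∈-∩⁻ (λ j → A j y) (λ j → B j x) {j} q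

    -- A common point of Aⱼ and Bₖ is none of the deleted ones: `y` is in Aₖ and `x` in Bⱼ, while
    -- `x′` is not in Bₖ and `y′` not in Aⱼ. So Bollobás' bound applies to the deleted system.
    meet′ : ∀ {j k} → j ∈ member → k ∈ member → j ≢ k → ∃ λ w → w ∈ A′ j × w ∈ B′ k
    meet′ {j} {k} pⱼ pₖ j≢k with member⁻ pⱼ | member⁻ pₖ
    ... | j-act , y∈Aⱼ , x∈Bⱼ | k-act , y∈Aₖ , x∈Bₖ with meet j-act k-act j≢k
    ...   | w , w∈Aⱼ , w∈Bₖ = w
      , ∈-─⁺ (A j ─ y) (∈-─⁺ (A j) w∈Aⱼ λ { refl → disjoint k y y∈Aₖ w∈Bₖ }) (λ { refl → Member.x′∉Bⱼ k-act y∈Aₖ x∈Bₖ w∈Bₖ })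
      , ∈-─⁺ (B k ─ x) (∈-─⁺ (B k) w∈Bₖ λ { refl → disjoint j x w∈Aⱼ x∈Bⱼ }) (λ { refl → Member.y′∉Aⱼ j-act y∈Aⱼ x∈Bⱼ w∈Aⱼ })

    -- A separating pair j ≠ i puts a point of Bᵢ = {y, y′} before a point of Aᵢ = {x, x′}, and on
    -- the chain only `y` before `x` is possible. The pair i itself would need `x` before `y`.
    only-members : ∀ {j o} → j ∈ active → ¬ (y ∈ A j × x ∈ B j) →
      ¬ ((A j ≺ B j) o × (x′ before y) o × (y before x) o × (x before y′) o)
    only-members {j} {o} j-act ¬yx (A≺B , x′<y , y<x , x<y′) with i ≟ j
    ... | yes refl = <-asym y<x (A≺B x y x∈Aᵢ y∈Bᵢ)
    ... | no i≢j with meet i-act j-act i≢j | meet j-act i-act (i≢j ∘ sym)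
    ...   | v , v∈Aᵢ , v∈Bⱼ | w , w∈Aⱼ , w∈Bᵢ with Aᵢ-only v∈Aᵢ | Bᵢ-only w∈Bᵢ | A≺B w v w∈Aⱼ v∈Bⱼ
    ...     | inj₁ refl | inj₁ refl | _     = ¬yx (w∈Aⱼ , v∈Bⱼ)
    ...     | inj₁ refl | inj₂ refl | y′<x  = <-asym x<y′ y′<x
    ...     | inj₂ refl | inj₁ refl | y<x′  = <-asym x′<y y<x′
    ...     | inj₂ refl | inj₂ refl | y′<x′ = <-asym (<-trans x′<y (<-trans y<x x<y′)) y′<x′

    40covered≤n! : 40 * Covered (chain₄? x′ y x y′) ≤ n !
    40covered≤n! = begin
      40 * Covered (chain₄? x′ y x y′)                           ≡⟨ *-distribˡ-sum 40 term ⟩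
      sum (λ j → 40 * term j)                                    ≤⟨ sum-mono _ _ bound ⟩
      covered member A′ B′ ⊤?                                    ≤⟨ Intersecting.covered≤count member A′ B′ A′#B′ meet′ ⊤? ⟩
      count ⊤?                                                   ≡⟨ count-all ⊤? tt ⟩
      n !                                                        ∎
      where
      open ≤-Reasoning
      ⊤? : Decidable {A = Order n} (λ _ → ⊤)
      ⊤? _ = yes tt
      chain-count : Fin m → ℕ
      chain-count j = count (λ o → ≺? (A j) (B j) o ×-dec chain₄? x′ y x y′ o)
      term : Fin m → ℕ
      term j = ι (j ∈? active) * chain-count j
      bound : ∀ j → 40 * term j ≤ ι (j ∈? member) * count (λ o → ≺? (A′ j) (B′ j) o ×-dec ⊤? o)
      bound j with j ∈? active
      ... | no _ = z≤n
      ... | yes j-act with (y ∈? A j) ×-dec (x ∈? B j)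
      ...   | no ¬yx = ≤-trans (≤-reflexive (cong (λ k → 40 * (1 * k))
                (count-none (λ o → ≺? (A j) (B j) o ×-dec chain₄? x′ y x y′ o) (only-members j-act ¬yx)))) z≤n
      ...   | yes (y∈Aⱼ , x∈Bⱼ) = begin
        40 * (1 * chain-count j)                                 ≡⟨ cong (40 *_) (*-identityˡ (chain-count j)) ⟩
        40 * chain-count j                                       ≤⟨ Member.40count≤count j-act y∈Aⱼ x∈Bⱼ ⟩
        count (≺? (A′ j) (B′ j))                                 ≡⟨ count-cong (≺? (A′ j) (B′ j)) (λ o → ≺? (A′ j) (B′ j) o ×-dec ⊤? o) (_, tt) proj₁ ⟩
        count (λ o → ≺? (A′ j) (B′ j) o ×-dec ⊤? o)              ≡⟨ sym (*-identityˡ _) ⟩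
        1 * count (λ o → ≺? (A′ j) (B′ j) o ×-dec ⊤? o)          ≡⟨ cong (_* count (λ o → ≺? (A′ j) (B′ j) o ×-dec ⊤? o)) (sym (ι-true (member⁺ j-act y∈Aⱼ x∈Bⱼ) (j ∈? member))) ⟩
        ι (j ∈? member) * count (λ o → ≺? (A′ j) (B′ j) o ×-dec ⊤? o) ∎

    n!≤24chain : n ! ≤ 24 * count (chain₄? x′ y x y′)
    n!≤24chain = n!≤24count-chain₄ (≢-AB x′∈Aᵢ y∈Bᵢ) (x≢x′ ∘ sym) (≢-AB x′∈Aᵢ y′∈Bᵢ)
                                    (≢-AB x∈Aᵢ y∈Bᵢ ∘ sym) y≢y′ (≢-AB x∈Aᵢ y′∈Bᵢ)

-- Adding up the unseparated orders

ι-×-⊎ : ∀ {R : Set} (p : Dec P) (q : Dec Q) (r : Dec R) → ι (p ×-dec (q ⊎-dec r)) ≤ ι (p ×-dec q) + ι (p ×-dec r)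
ι-×-⊎ (yes _) (yes _) r       = s≤s z≤n
ι-×-⊎ (yes _) (no _)  (yes _) = ≤-refl
ι-×-⊎ (yes _) (no _)  (no _)  = z≤n
ι-×-⊎ (no _)  q       r       = z≤n

ι-⊎ : ¬ (P × Q) → (p : Dec P) (q : Dec Q) → ι p + ι q ≤ ι (p ⊎-dec q)
ι-⊎ ¬pq (yes p) (yes q) = contradiction (p , q) ¬pq
ι-⊎ ¬pq (yes _) (no _)  = ≤-refl
ι-⊎ ¬pq (no _)  (yes _) = ≤-refl
ι-⊎ ¬pq (no _)  (no _)  = z≤n

module Bounds (S : CrossSystem m n) where
  open CrossSystem S
  open Pair S

  covered-⊎ : {R R′ : Order n → Set} (R? : Decidable R) (R′? : Decidable R′) →
    Covered (λ o → R? o ⊎-dec R′? o) ≤ Covered R? + Covered R′?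
  covered-⊎ R? R′? = begin
    Covered (λ o → R? o ⊎-dec R′? o)                                           ≤⟨ sum-mono _ _ bound ⟩
    sum (λ j → ι (j ∈? active) * hit R? j + ι (j ∈? active) * hit R′? j)       ≡⟨ ∑-distrib-+ (λ j → ι (j ∈? active) * hit R? j) _ ⟩
    Covered R? + Covered R′?                                                   ∎
    where
    open ≤-Reasoning
    hit : {R : Order n → Set} → Decidable R → Fin m → ℕ
    hit R? j = count λ o → ≺? (A j) (B j) o ×-dec R? o
    bound : ∀ j → ι (j ∈? active) * hit (λ o → R? o ⊎-dec R′? o) j ≤ ι (j ∈? active) * hit R? j + ι (j ∈? active) * hit R′? j
    bound j = begin
      ι (j ∈? active) * hit (λ o → R? o ⊎-dec R′? o) j
        ≤⟨ *-monoʳ-≤ (ι (j ∈? active)) (∑ₒ-mono _ _ λ o → ι-×-⊎ (≺? (A j) (B j) o) (R? o) (R′? o)) ⟩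
      ι (j ∈? active) * ∑ₒ (λ o → ι (≺? (A j) (B j) o ×-dec R? o) + ι (≺? (A j) (B j) o ×-dec R′? o))
        ≡⟨ cong (ι (j ∈? active) *_) (∑ₒ-distrib-+ (λ o → ι (≺? (A j) (B j) o ×-dec R? o)) (λ o → ι (≺? (A j) (B j) o ×-dec R′? o))) ⟩
      ι (j ∈? active) * (hit R? j + hit R′? j)
        ≡⟨ *-distribˡ-+ (ι (j ∈? active)) (hit R? j) (hit R′? j) ⟩
      ι (j ∈? active) * hit R? j + ι (j ∈? active) * hit R′? j ∎

  -- Each of the two disjoint events contains at least 1/24 - 1/40 of all orders unseparated,
  -- together 1/30.
  two-events : {R R′ : Order n → Set} (R? : Decidable R) (R′? : Decidable R′) → (∀ {o} → ¬ (R o × R′ o)) →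
    n ! ≤ 24 * count R? → n ! ≤ 24 * count R′? → 40 * Covered R? ≤ n ! → 40 * Covered R′? ≤ n ! → 30 * Total ≤ 29 * n !
  -- All is scaled by 120 = lcm(24, 40), so the lower bounds enter five times and the upper bounds
  -- three times.
  two-events R? R′? R#R′ big big′ small small′ = *-cancelˡ-≤ 4 (+-cancelʳ-≤ (5 * n ! + 5 * n !) _ _ (begin
    4 * (30 * Total) + (5 * n ! + 5 * n !)                        ≤⟨ +-monoʳ-≤ (4 * (30 * Total)) (+-mono-≤ (*-monoʳ-≤ 5 big) (*-monoʳ-≤ 5 big′)) ⟩
    4 * (30 * Total) + (5 * (24 * r) + 5 * (24 * r′))             ≡⟨ regroup₁ Total r r′ ⟩
    120 * (Total + (r + r′))                                      ≤⟨ *-monoʳ-≤ 120 (+-monoʳ-≤ Total r+r′≤) ⟩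
    120 * (Total + count (λ o → R? o ⊎-dec R′? o))                ≤⟨ *-monoʳ-≤ 120 (total+count≤covered+n! (λ o → R? o ⊎-dec R′? o)) ⟩
    120 * (Covered (λ o → R? o ⊎-dec R′? o) + n !)                ≤⟨ *-monoʳ-≤ 120 (+-monoˡ-≤ (n !) (covered-⊎ R? R′?)) ⟩
    120 * (Covered R? + Covered R′? + n !)                        ≡⟨ regroup₂ (Covered R?) (Covered R′?) (n !) ⟩
    3 * (40 * Covered R?) + 3 * (40 * Covered R′?) + 120 * n !    ≤⟨ +-monoˡ-≤ (120 * n !) (+-mono-≤ (*-monoʳ-≤ 3 small) (*-monoʳ-≤ 3 small′)) ⟩
    3 * n ! + 3 * n ! + 120 * n !                                 ≡⟨ regroup₃ (n !) ⟩
    4 * (29 * n !) + (5 * n ! + 5 * n !)                          ∎))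
    where
    open ≤-Reasoning
    r  = count R?
    r′ = count R′?
    r+r′≤ : r + r′ ≤ count (λ o → R? o ⊎-dec R′? o)
    r+r′≤ = ≤-trans (≤-reflexive (sym (∑ₒ-distrib-+ (λ o → ι (R? o)) (λ o → ι (R′? o))))) (∑ₒ-mono _ _ λ o → ι-⊎ R#R′ (R? o) (R′? o))
    regroup₁ : ∀ t r s → 4 * (30 * t) + (5 * (24 * r) + 5 * (24 * s)) ≡ 120 * (t + (r + s))
    regroup₁ = solve-∀
    regroup₂ : ∀ c d f → 120 * (c + d + f) ≡ 3 * (40 * c) + 3 * (40 * d) + 120 * f
    regroup₂ = solve-∀
    regroup₃ : ∀ f → 3 * f + 3 * f + 120 * f ≡ 4 * (29 * f) + (5 * f + 5 * f)
    regroup₃ = solve-∀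

  -- The choices of (x, y) form two opposite couples: (x, y) with (x′, y′), and (x′, y) with (x,
  -- y′). By `tight-opposite` each couple has a choice without an exceptional pair.
  square-bound : ∀ {i x x′ y y′} → Square i x x′ y y′ → 30 * Total ≤ 29 * n !
  square-bound {i} {x} {x′} {y} {y′} sq = choose (loose-or-opposite sq) (loose-or-opposite (swapA sq))
    where
    Loose : (x x′ y y′ : Fin n) → Set
    Loose x x′ y y′ = ∀ j → ¬ Tight x x′ y y′ j

    loose-or-opposite : ∀ {x x′ y y′} → Square i x x′ y y′ → Loose x x′ y y′ ⊎ Loose x′ x y′ y
    loose-or-opposite {x} {x′} {y} {y′} sq with any? (tight? x x′ y y′)
    ... | no ∄          = inj₁ λ j t → ∄ (j , t)
    ... | yes (_ , tⱼ) = inj₂ λ k tₖ → tight-opposite sq tⱼ tₖ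

    combine : ∀ {x₁ x₁′ y₁ y₁′ x₂ x₂′ y₂ y₂′} (sq₁ : Square i x₁ x₁′ y₁ y₁′) (sq₂ : Square i x₂ x₂′ y₂ y₂′) →
      Loose x₁ x₁′ y₁ y₁′ → Loose x₂ x₂′ y₂ y₂′ →
      (∀ {o} → ¬ (((x₁′ before y₁) o × (y₁ before x₁) o × (x₁ before y₁′) o) × ((x₂′ before y₂) o × (y₂ before x₂) o × (x₂ before y₂′) o))) →
      30 * Total ≤ 29 * n !
    combine {x₁} {x₁′} {y₁} {y₁′} {x₂} {x₂′} {y₂} {y₂′} sq₁ sq₂ loose₁ loose₂ excl =
      two-events (chain₄? x₁′ y₁ x₁ y₁′) (chain₄? x₂′ y₂ x₂ y₂′) excl
        (Chain.n!≤24chain sq₁ loose₁) (Chain.n!≤24chain sq₂ loose₂)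
        (Chain.40covered≤n! sq₁ loose₁) (Chain.40covered≤n! sq₂ loose₂)

    -- Chains from different couples order some point of Aᵢ and some point of Bᵢ oppositely, so the
    -- two events are disjoint.
    choose : Loose x x′ y y′ ⊎ Loose x′ x y′ y → Loose x′ x y y′ ⊎ Loose x x′ y′ y → 30 * Total ≤ 29 * n !
    choose (inj₁ l₁) (inj₁ l₂) = combine sq (swapA sq) l₁ l₂ λ ((x′<y , _) , _ , y<x′ , _) → <-asym x′<y y<x′
    choose (inj₁ l₁) (inj₂ l₂) = combine sq (swapB sq) l₁ l₂ λ ((_ , _ , x<y′) , _ , y′<x , _) → <-asym x<y′ y′<x
    choose (inj₂ l₁) (inj₁ l₂) = combine (swapA (swapB sq)) (swapA sq) l₁ l₂ λ ((_ , y′<x′ , _) , _ , _ , x′<y′) → <-asym y′<x′ x′<y′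
    choose (inj₂ l₁) (inj₂ l₂) = combine (swapA (swapB sq)) (swapB sq) l₁ l₂ λ ((x<y′ , _) , _ , y′<x , _) → <-asym x<y′ y′<x

  2×2-bound : ∀ {i} → i ∈ active → card (A i) ≡ 2 → card (B i) ≡ 2 → 30 * Total ≤ 29 * n !
  2×2-bound {i} i-act a≡2 b≡2
    with card>0⇒∃ (A i) (subst (0 <_) (sym a≡2) (s≤s z≤n)) | card>0⇒∃ (B i) (subst (0 <_) (sym b≡2) (s≤s z≤n))
  ... | x , x∈ | y , y∈ with card≡2⇒pair (A i) a≡2 x∈ | card≡2⇒pair (B i) b≡2 y∈
  ...   | x′ , x′∈ , x≢x′ , A-only | y′ , y′∈ , y≢y′ , B-only = square-bound {x = x} {x′} {y} {y′} record
    { i-act = i-act ; x∈Aᵢ = x∈ ; x′∈Aᵢ = x′∈ ; y∈Bᵢ = y∈ ; y′∈Bᵢ = y′∈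
    ; x≢x′ = x≢x′ ; y≢y′ = y≢y′ ; Aᵢ-only = A-only ; Bᵢ-only = B-only }

  -- Two pairs that are small on opposite sides

  module Opposite {i k} (i-act : i ∈ active) (k-act : k ∈ active) (3≤Aᵢ : 3 ≤ card (A i)) (Bᵢ≡2 : card (B i) ≡ 2)
                  (Aₖ≡2 : card (A k) ≡ 2) (3≤Bₖ : 3 ≤ card (B k)) where

    i≢k : i ≢ k
    i≢k refl = contradiction Aₖ≡2 (>⇒≢ 3≤Aᵢ)

    module Path {x z y} (z∈Aₖ : z ∈ A k) (z∈Bᵢ : z ∈ B i) (x∈Aₖ : x ∈ A k) (y∈Bᵢ : y ∈ B i) (z≢x : z ≢ x) (z≢y : z ≢ y)
                (Aₖ-only : ∀ {w} → w ∈ A k → w ≡ z ⊎ w ≡ x) (Bᵢ-only : ∀ {w} → w ∈ B i → w ≡ z ⊎ w ≡ y) where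

      x≢y : x ≢ y
      x≢y refl = z≢x (meet-unique k-act i-act (i≢k ∘ sym) z∈Aₖ z∈Bᵢ x∈Aₖ y∈Bᵢ)

      -- A further separating pair puts a point of Bᵢ = {z, y} strictly before a point of Aₖ = {z,
      -- x}, against x < z < y.
      only-ik : ∀ {j o} → j ∈ active → j ≢ i → j ≢ k → ¬ ((A j ≺ B j) o × (x before z) o × (z before y) o)
      only-ik j-act j≢i j≢k (A≺B , x<z , z<y) with meet j-act i-act j≢i | meet k-act j-act (j≢k ∘ sym)
      ... | w , w∈Aⱼ , w∈Bᵢ | v , v∈Aₖ , v∈Bⱼ with Bᵢ-only w∈Bᵢ | Aₖ-only v∈Aₖ | A≺B w v w∈Aⱼ v∈Bⱼ
      ...   | inj₁ refl | inj₁ refl | z<z = <-irrefl refl z<z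
      ...   | inj₁ refl | inj₂ refl | z<x = <-asym x<z z<x
      ...   | inj₂ refl | inj₁ refl | y<z = <-asym z<y y<z
      ...   | inj₂ refl | inj₂ refl | y<x = <-asym (<-trans x<z z<y) y<x

      hit : Fin m → ℕ
      hit j = count λ o → ≺? (A j) (B j) o ×-dec chain₃? x z y o

      -- At most 1/10 of all orders have Aᵢ before Bᵢ, and half of these have `z` before `y`, both
      -- in Bᵢ.
      20hitᵢ≤n! : 20 * hit i ≤ n !
      20hitᵢ≤n! = begin
        20 * hit i                                                      ≤⟨ *-monoʳ-≤ 20 (count-mono (λ o → ≺? (A i) (B i) o ×-dec chain₃? x z y o) (λ o → ≺? (A i) (B i) o ×-dec before? z y o)
                                                                             λ (A≺B , _ , z<y) → A≺B , z<y) ⟩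
        20 * h                                                          ≡⟨ *-assoc 10 2 h ⟩
        10 * (2 * h)                                                    ≡⟨ cong (10 *_) (count-half-B (A i) (B i) (disjoint i) z≢y z∈Bᵢ y∈Bᵢ) ⟩
        10 * count (≺? (A i) (B i))                                     ≤⟨ 10count≤n! (A i) (B i) (disjoint i) 3≤Aᵢ Bᵢ≡2 ⟩
        n !                                                             ∎
        where
        open ≤-Reasoning
        h = count λ o → ≺? (A i) (B i) o ×-dec before? z y o

      20hitₖ≤n! : 20 * hit k ≤ n !
      20hitₖ≤n! = begin
        20 * hit k                                                      ≤⟨ *-monoʳ-≤ 20 (count-mono (λ o → ≺? (A k) (B k) o ×-dec chain₃? x z y o) (λ o → ≺? (A k) (B k) o ×-dec before? x z o)
                                                                             λ (A≺B , x<z , _) → A≺B , x<z) ⟩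
        20 * h                                                          ≡⟨ *-assoc 10 2 h ⟩
        10 * (2 * h)                                                    ≡⟨ cong (10 *_) (count-half-A (A k) (B k) (disjoint k) (z≢x ∘ sym) x∈Aₖ z∈Aₖ) ⟩
        10 * count (≺? (A k) (B k))                                     ≡⟨ cong (10 *_) (count-≺-sym (A k) (B k) (disjoint k)) ⟩
        10 * count (≺? (B k) (A k))                                     ≤⟨ 10count≤n! (B k) (A k) (λ w p q → disjoint k w q p) 3≤Bₖ Aₖ≡2 ⟩
        n !                                                             ∎
        where
        open ≤-Reasoning
        h = count λ o → ≺? (A k) (B k) o ×-dec before? x z o

      covered≤hits : Covered (chain₃? x z y) ≤ hit i + hit k
      covered≤hits = begin
        Covered (chain₃? x z y)                                              ≤⟨ sum-mono _ _ bound ⟩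
        sum (λ j → ι (j ≟ i) * hit i + ι (j ≟ k) * hit k)                    ≡⟨ ∑-distrib-+ (λ j → ι (j ≟ i) * hit i) _ ⟩
        sum (λ j → ι (j ≟ i) * hit i) + sum (λ j → ι (j ≟ k) * hit k)        ≤⟨ +-mono-≤ (select i) (select k) ⟩
        hit i + hit k                                                        ∎
        where
        open ≤-Reasoning
        select : ∀ l → sum (λ j → ι (j ≟ l) * hit l) ≤ hit l
        select l = begin
          sum (λ j → ι (j ≟ l) * hit l)   ≡⟨ sym (*-distribʳ-sum (hit l) (λ j → ι (j ≟ l))) ⟩
          sum (λ j → ι (j ≟ l)) * hit l   ≤⟨ *-monoˡ-≤ (hit l) (sum-disjoint (_≟ l) λ p q → trans p (sym q)) ⟩
          1 * hit l                       ≡⟨ *-identityˡ (hit l) ⟩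
          hit l                           ∎
        bound : ∀ j → ι (j ∈? active) * hit j ≤ ι (j ≟ i) * hit i + ι (j ≟ k) * hit k
        bound j with j ∈? active
        ... | no _      = z≤n
        ... | yes j-act with j ≟ i
        ...   | yes refl = m≤m+n _ _
        ...   | no j≢i with j ≟ k
        ...     | yes refl = ≤-refl
        ...     | no j≢k   = ≤-reflexive (trans (*-identityˡ (hit j)) (count-none (λ o → ≺? (A j) (B j) o ×-dec chain₃? x z y o) (only-ik j-act j≢i j≢k)))

      -- The saving is 1/6 - 1/20 - 1/20 = 1/15, twice what is required; the surplus is given away
      -- as `2 * n !`.
      path-bound : 30 * Total ≤ 29 * n !
      path-bound = *-cancelˡ-≤ 2 (+-cancelʳ-≤ (10 * n !) _ _ (begin
        2 * (30 * Total) + 10 * n !                   ≤⟨ +-monoʳ-≤ (2 * (30 * Total)) (*-monoʳ-≤ 10 (n!≤6count-chain₃ (z≢x ∘ sym) x≢y z≢y)) ⟩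
        2 * (30 * Total) + 10 * (6 * K)               ≡⟨ regroup₁ Total K ⟩
        60 * (Total + K)                              ≤⟨ *-monoʳ-≤ 60 (total+count≤covered+n! (chain₃? x z y)) ⟩
        60 * (Covered (chain₃? x z y) + n !)          ≤⟨ *-monoʳ-≤ 60 (+-monoˡ-≤ (n !) covered≤hits) ⟩
        60 * (hit i + hit k + n !)                    ≡⟨ regroup₂ (hit i) (hit k) (n !) ⟩
        3 * (20 * hit i) + 3 * (20 * hit k) + 60 * n ! ≤⟨ +-monoˡ-≤ (60 * n !) (+-mono-≤ (*-monoʳ-≤ 3 20hitᵢ≤n!) (*-monoʳ-≤ 3 20hitₖ≤n!)) ⟩
        3 * n ! + 3 * n ! + 60 * n !                  ≤⟨ m≤m+n _ (2 * n !) ⟩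
        3 * n ! + 3 * n ! + 60 * n ! + 2 * n !        ≡⟨ regroup₃ (n !) ⟩
        2 * (29 * n !) + 10 * n !                     ∎))
        where
        open ≤-Reasoning
        K = count (chain₃? x z y)
        regroup₁ : ∀ t k → 2 * (30 * t) + 10 * (6 * k) ≡ 60 * (t + k)
        regroup₁ = solve-∀
        regroup₂ : ∀ c d f → 60 * (c + d + f) ≡ 3 * (20 * c) + 3 * (20 * d) + 60 * f
        regroup₂ = solve-∀
        regroup₃ : ∀ f → 3 * f + 3 * f + 60 * f + 2 * f ≡ 2 * (29 * f) + 10 * f
        regroup₃ = solve-∀

    opposite-bound : 30 * Total ≤ 29 * n !
    opposite-bound with meet k-act i-act (i≢k ∘ sym)
    ... | z , z∈Aₖ , z∈Bᵢ with card≡2⇒pair (A k) Aₖ≡2 z∈Aₖ | card≡2⇒pair (B i) Bᵢ≡2 z∈Bᵢ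
    ...   | x , x∈Aₖ , z≢x , A-only | y , y∈Bᵢ , z≢y , B-only = Path.path-bound z∈Aₖ z∈Bᵢ x∈Aₖ y∈Bᵢ z≢x z≢y A-only B-only

-- Induction on the ground set

swap-system : CrossSystem m n → CrossSystem m n
swap-system S = record
  { active = active ; A = B ; B = A
  ; disjoint = λ j z z∈B z∈A → disjoint j z z∈A z∈B
  ; cross = λ {i} {j} i-act j-act i≢j → trans (card-∩-comm (B i) (A j)) (cross j-act i-act (i≢j ∘ sym))
  ; 2≤A = 2≤B ; 2≤B = 2≤A }
  where open CrossSystem S

total-swap : ∀ (S : CrossSystem m n) → CrossSystem.Total S ≡ CrossSystem.Total (swap-system S)
total-swap S = sum-cong-≗ λ j → cong (ι (j ∈? active) *_) (count-≺-sym (A j) (B j) (disjoint j))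
  where open CrossSystem S

module Reveal (S : CrossSystem m (suc n)) (3≤B : ∀ {j} → j ∈ CrossSystem.active S → 3 ≤ card (CrossSystem.B S j)) where
  open CrossSystem S

  module _ (z : Fin (suc n)) where

    survivors : FinSet m
    survivors = active ∩ᶠ (λ j → not (A j z))

    survivor⁻ : ∀ {j} → j ∈ survivors → j ∈ active × ¬ z ∈ A j
    survivor⁻ {j} p with ∈-∩⁻ active (λ j → not (A j z)) {j} p
    ... | j-act , q = j-act , λ z∈Aⱼ → case trans (sym q) (cong not z∈Aⱼ) of λ ()

    survivor⁺ : ∀ {j} → j ∈ active → ¬ z ∈ A j → j ∈ survivors
    survivor⁺ {j} j-act z∉Aⱼ = ∈-∩⁺ active (λ j → not (A j z)) {j} j-act (cong not (∉⇒false (A j) z∉Aⱼ))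

    card-∌ : ∀ (Z : FinSet (suc n)) → ¬ z ∈ Z → card (Z ∘ punchIn z) ≡ card Z
    card-∌ Z z∉Z = sym (trans (card-punchIn Z z) (cong (_+ card (Z ∘ punchIn z)) (ι-false z∉Z (z ∈? Z))))

    -- The system conditioned on `z` being last. As `z` is in no surviving Aⱼ, these sets and all
    -- intersections keep their sizes; Bⱼ loses at most one point, which `3≤B` allows for.
    restrict : CrossSystem m n
    restrict = record
      { active = survivors
      ; A = λ j → A j ∘ punchIn z
      ; B = λ j → B j ∘ punchIn z
      ; disjoint = λ j u → disjoint j (punchIn z u)
      ; cross = λ {i} {j} i-sur j-sur i≢j →
          trans (card-∌ (A i ∩ᶠ B j) (λ p → proj₂ (survivor⁻ i-sur) (proj₁ (∈-∩⁻ (A i) (B j) p))))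
                (cross (proj₁ (survivor⁻ i-sur)) (proj₁ (survivor⁻ j-sur)) i≢j)
      ; 2≤A = λ {j} j-sur → subst (2 ≤_) (sym (card-∌ (A j) (proj₂ (survivor⁻ j-sur)))) (2≤A (proj₁ (survivor⁻ j-sur)))
      ; 2≤B = λ {j} j-sur → ≤-pred (begin
          3                                        ≤⟨ 3≤B (proj₁ (survivor⁻ j-sur)) ⟩
          card (B j)                               ≡⟨ card-punchIn (B j) z ⟩
          ι (z ∈? B j) + card (B j ∘ punchIn z)    ≤⟨ +-monoˡ-≤ _ (ι≤1 (z ∈? B j)) ⟩
          1 + card (B j ∘ punchIn z)               ∎) }
      where
      open ≤-Reasoning
      ι≤1 : (p : Dec P) → ι p ≤ 1
      ι≤1 (yes _) = ≤-refl
      ι≤1 (no _)  = z≤n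

  -- Apply `count-reveal` to every active pair and exchange the sums; the factor for `z` outside Aⱼ
  -- turns into membership in `survivors z`.
  total-reveal : Total ≡ sum λ z → CrossSystem.Total (restrict z)
  total-reveal = begin
    Total                                                                         ≡⟨ sum-cong-≗ expand ⟩
    sum (λ j → sum λ z → ι (j ∈? survivors z) * rest j z)                         ≡⟨ ∑-comm (λ j z → ι (j ∈? survivors z) * rest j z) ⟩
    sum (λ z → CrossSystem.Total (restrict z))                                    ∎
    where
    open ≡-Reasoning
    rest : Fin m → Fin (suc n) → ℕ
    rest j z = count (≺? (A j ∘ punchIn z) (B j ∘ punchIn z))
    expand : ∀ j → ι (j ∈? active) * count (≺? (A j) (B j)) ≡ sum λ z → ι (j ∈? survivors z) * rest j z
    expand j with j ∈? active
    ... | no j-idle = sym (sum-zero λ z → cong (_* rest j z) (ι-false (j-idle ∘ proj₁ ∘ survivor⁻ z) (j ∈? survivors z)))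
    ... | yes j-act = trans (*-identityˡ _) (trans (count-reveal (A j) (B j) (≤-trans (s≤s z≤n) (2≤B j-act)))
      (sum-cong-≗ λ z → cong (_* rest j z) (ι-cong (survivor⁺ z j-act) (proj₂ ∘ survivor⁻ z) (¬? (z ∈? A j)) (j ∈? survivors z))))

  reveal-bound : (∀ S′ → 30 * CrossSystem.Total {m} {n} S′ ≤ 29 * n !) → 30 * Total ≤ 29 * (suc n) !
  reveal-bound ih = begin
    30 * Total                                          ≡⟨ cong (30 *_) total-reveal ⟩
    30 * sum (λ z → CrossSystem.Total (restrict z))     ≡⟨ *-distribˡ-sum 30 (λ z → CrossSystem.Total (restrict z)) ⟩
    sum (λ z → 30 * CrossSystem.Total (restrict z))     ≤⟨ sum-mono _ _ (ih ∘ restrict) ⟩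
    sum {suc n} (λ _ → 29 * n !)                        ≡⟨ sum-const (suc n) (29 * n !) ⟩
    suc n * (29 * n !)                                  ≡⟨ regroup (suc n) (n !) ⟩
    29 * (suc n) !                                      ∎
    where
    open ≤-Reasoning
    regroup : ∀ s f → s * (29 * f) ≡ 29 * (s * f)
    regroup = solve-∀

module _ (S : CrossSystem m (suc n)) (ih : ∀ S′ → 30 * CrossSystem.Total {m} {n} S′ ≤ 29 * n !) where
  open CrossSystem S

  private
    Bounded : Set
    Bounded = 30 * Total ≤ 29 * (suc n) !

    -- Either one of the two pairs has both sides of size 2, as happens when i = k, or the pairs are
    -- small on opposite sides.
    two-small : ∀ {i k} → i ∈ active → k ∈ active → card (B i) ≡ 2 → card (A k) ≡ 2 →
                Dec (card (A i) ≡ 2) → Dec (card (B k) ≡ 2) → Bounded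
    two-small i-act k-act Bᵢ≡2 Aₖ≡2 (yes Aᵢ≡2) _          = Bounds.2×2-bound S i-act Aᵢ≡2 Bᵢ≡2
    two-small i-act k-act Bᵢ≡2 Aₖ≡2 (no _)     (yes Bₖ≡2) = Bounds.2×2-bound S k-act Aₖ≡2 Bₖ≡2
    two-small i-act k-act Bᵢ≡2 Aₖ≡2 (no Aᵢ≢2)  (no Bₖ≢2)  = Bounds.Opposite.opposite-bound S i-act k-act
      (≤∧≢⇒< (2≤A i-act) (Aᵢ≢2 ∘ sym)) Bᵢ≡2 Aₖ≡2 (≤∧≢⇒< (2≤B k-act) (Bₖ≢2 ∘ sym))

    by-cases : Dec (∃ λ j → j ∈ active × card (A j) ≡ 2) → Dec (∃ λ j → j ∈ active × card (B j) ≡ 2) → Bounded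
    by-cases _        (no ∄B₂) = Reveal.reveal-bound S (λ {j} j-act → ≤∧≢⇒< (2≤B j-act) λ eq → ∄B₂ (j , j-act , sym eq)) ih
    by-cases (no ∄A₂) (yes _)  = ≤-trans (≤-reflexive (cong (30 *_) (total-swap S)))
      (Reveal.reveal-bound (swap-system S) (λ {j} j-act → ≤∧≢⇒< (2≤A j-act) λ eq → ∄A₂ (j , j-act , sym eq)) ih)
    by-cases (yes (k , k-act , Aₖ≡2)) (yes (i , i-act , Bᵢ≡2)) =
      two-small i-act k-act Bᵢ≡2 Aₖ≡2 (card (A i) ℕ.≟ 2) (card (B k) ℕ.≟ 2)

  system-step : Bounded
  system-step = by-cases (any? λ j → (j ∈? active) ×-dec (card (A j) ℕ.≟ 2)) (any? λ j → (j ∈? active) ×-dec (card (B j) ℕ.≟ 2))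

system-bound : ∀ n (S : CrossSystem m n) → 30 * CrossSystem.Total S ≤ 29 * n !
system-bound zero    S = ≤-trans (≤-reflexive (cong (30 *_) (sum-zero idle))) z≤n
  where
  open CrossSystem S
  idle : ∀ j → ι (j ∈? active) * count (≺? (A j) (B j)) ≡ 0
  idle j with j ∈? active
  ... | no _      = refl
  -- An empty ground set has no subsets of size 2, so no pair is active.
  ... | yes j-act = contradiction (2≤A j-act) λ ()
system-bound (suc n) S = system-step S (system-bound n)

-- Sets of exactly the prescribed sizes

record Family {m} (a b : Fin m → ℕ) (n : ℕ) : Set where
  field
    A B      : Fin m → FinSet n
    disjoint : ∀ j → Disjoint (A j) (B j)
    cross    : ∀ i j → i ≢ j → card (A i ∩ᶠ B j) ≡ 1
    A≤a      : ∀ j → card (A j) ≤ a j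
    B≤b      : ∀ j → card (B j) ≤ b j

swap-family : {a b : Fin m → ℕ} → Family a b n → Family b a n
swap-family F = record
  { A = B ; B = A
  ; disjoint = λ j z z∈B z∈A → disjoint j z z∈A z∈B
  ; cross = λ i j i≢j → trans (card-∩-comm (B i) (A j)) (cross j i (i≢j ∘ sym))
  ; A≤a = B≤b ; B≤b = A≤a }
  where open Family F

_++_ : FinSet m → FinSet n → FinSet (m + n)
_++_ {zero}  X A = A
_++_ {suc m} X A zero    = X zero
_++_ {suc m} X A (suc z) = ((X ∘ suc) ++ A) z

card-++ : ∀ (X : FinSet m) (A : FinSet n) → card (X ++ A) ≡ card X + card A
card-++ {zero}  X A = refl
card-++ {suc m} X A = trans (cong (λ k → ι (zero ∈? X) + k) (card-++ (X ∘ suc) A)) (sym (+-assoc (ι (zero ∈? X)) (card (X ∘ suc)) (card A)))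

++-disjoint : ∀ (X Y : FinSet m) (A B : FinSet n) → Disjoint X Y → Disjoint A B → Disjoint (X ++ A) (Y ++ B)
++-disjoint {zero}  X Y A B X#Y A#B = A#B
++-disjoint {suc m} X Y A B X#Y A#B zero    = X#Y zero
++-disjoint {suc m} X Y A B X#Y A#B (suc z) = ++-disjoint (X ∘ suc) (Y ∘ suc) A B (X#Y ∘ suc) A#B z

++-∩ : ∀ (X Y : FinSet m) (A B : FinSet n) z → ((X ++ A) ∩ᶠ (Y ++ B)) z ≡ ((X ∩ᶠ Y) ++ (A ∩ᶠ B)) z
++-∩ {zero}  X Y A B z       = refl
++-∩ {suc m} X Y A B zero    = refl
++-∩ {suc m} X Y A B (suc z) = ++-∩ (X ∘ suc) (Y ∘ suc) A B z

module _ {a b : Fin m → ℕ} where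

  -- Every set A j that is too small receives its own fresh element.
  pad : Family a b n → Family a b (m + n)
  pad {n} F = record
    { A = λ j → fresh j ++ A j
    ; B = λ j → ∅ ++ B j
    ; disjoint = λ j → ++-disjoint (fresh j) ∅ (A j) (B j) (λ z _ z∈∅ → ∉∅ z z∈∅) (disjoint j)
    ; cross = λ i j i≢j → begin
        card ((fresh i ++ A i) ∩ᶠ (∅ ++ B j))      ≡⟨ card-cong _ _ (++-∩ (fresh i) ∅ (A i) (B j)) ⟩
        card ((fresh i ∩ᶠ ∅) ++ (A i ∩ᶠ B j))       ≡⟨ card-++ (fresh i ∩ᶠ ∅) (A i ∩ᶠ B j) ⟩
        card (fresh i ∩ᶠ ∅) + card (A i ∩ᶠ B j)     ≡⟨ cong₂ _+_ (sum-zero λ z → ι-false (λ p → ∉∅ z (proj₂ (∈-∩⁻ (fresh i) ∅ p))) (z ∈? (fresh i ∩ᶠ ∅))) (cross i j i≢j) ⟩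
        1                                         ∎
    ; A≤a = λ j → subst (_≤ a j) (sym (card-++ (fresh j) (A j))) (fits j (card (A j) <? a j))
    ; B≤b = λ j → subst (_≤ b j) (sym (trans (card-++ {m} ∅ (B j)) (cong (_+ card (B j)) (card-∅ m)))) (B≤b j) }
    where
    open Family F
    open ≡-Reasoning
    block : ∀ j → Dec (card (A j) < a j) → FinSet m
    block j (yes _) = ∅ ⊹ j
    block j (no _)  = ∅
    fresh : Fin m → FinSet m
    fresh j = block j (card (A j) <? a j)
    fits : ∀ j short? → card (block j short?) + card (A j) ≤ a j
    fits j (yes short) = subst (λ k → k + card (A j) ≤ a j) (sym (card-∅⊹ j)) short
    fits j (no _)      = subst (λ k → k + card (A j) ≤ a j) (sym (card-∅ m)) (A≤a j)

  -- Padding lowers the bound on the deficit of Aⱼ from `suc r` to `r`: either Aⱼ gains a point or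
  -- it had no deficit.
  pad-A : ∀ (F : Family a b n) {r} j → a j ≤ card (Family.A F j) + suc r → a j ≤ card (Family.A (pad F) j) + r
  pad-A F {r} j h with card (Family.A F j) <? a j
  ... | yes _  = ≤-trans h (≤-reflexive (sym (trans (cong (_+ r) (trans (card-++ (∅ ⊹ j) (A j)) (cong (_+ card (A j)) (card-∅⊹ j))))
                                                    (sym (+-suc (card (A j)) r)))))
    where open Family F
  ... | no ≮a = ≤-trans (≮⇒≥ ≮a) (≤-trans (≤-reflexive (sym (trans (card-++ {m} ∅ (A j)) (cong (_+ card (A j)) (card-∅ m))))) (m≤m+n _ r))
    where open Family F

  pad-B : ∀ (F : Family a b n) j → card (Family.B (pad F) j) ≡ card (Family.B F j)
  pad-B F j = trans (card-++ {m} ∅ (Family.B F j)) (cong (_+ card (Family.B F j)) (card-∅ m))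

  -- With `r` a bound on all deficits, `r` rounds of padding fill them. That |Bⱼ| stays put lets the
  -- two sides be treated in turn.
  saturate : ∀ r (F : Family a b n) → (∀ j → a j ≤ card (Family.A F j) + r) →
    ∃ λ n′ → ∃ λ (F′ : Family a b n′) → (∀ j → card (Family.A F′ j) ≡ a j) × (∀ j → card (Family.B F′ j) ≡ card (Family.B F j))
  saturate zero F h = _ , F , (λ j → ≤-antisym (Family.A≤a F j) (subst (a j ≤_) (+-identityʳ _) (h j))) , λ _ → refl
  saturate (suc r) F h with saturate r (pad F) (λ j → pad-A F j (h j))
  ... | n′ , F′ , A≡a , B≡ = n′ , F′ , A≡a , λ j → trans (B≡ j) (pad-B F j)

≤sum : ∀ (f : Fin m → ℕ) j → f j ≤ sum f
≤sum {suc m} f zero    = m≤m+n (f zero) _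
≤sum {suc m} f (suc j) = m≤n⇒m≤o+n (f zero) (≤sum (f ∘ suc) j)

-- At exact sizes, each summand of the theorem is the proportion of orders that its pair separates.
saturate-both : {a b : Fin m → ℕ} → Family a b n →
  ∃ λ n′ → ∃ λ (F′ : Family a b n′) → (∀ j → card (Family.A F′ j) ≡ a j) × (∀ j → card (Family.B F′ j) ≡ b j)
-- `sum a` is a crude common bound for the deficits.
saturate-both {a = a} {b} F with saturate (sum a) F (λ j → m≤n⇒m≤o+n _ (≤sum a j))
... | _ , F₁ , A₁≡a , _ with saturate (sum b) (swap-family F₁) (λ j → m≤n⇒m≤o+n _ (≤sum b j))
...   | n₂ , F₂ , B₂≡b , A₂≡A₁ = n₂ , swap-family F₂ , (λ j → trans (A₂≡A₁ j) (A₁≡a j)) , B₂≡b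

-- Passage to the rationals

C*a!b!≡[a+b]! : ∀ a b → ((a + b) C a) * (a ! * b !) ≡ (a + b) !
C*a!b!≡[a+b]! a b = subst (λ k → ((a + b) C a) * (a ! * k !) ≡ (a + b) !) (m+n∸m≡n a b) (begin
  ((a + b) C a) * (a ! * (a + b ∸ a) !)                                 ≡⟨ cong (_* (a ! * (a + b ∸ a) !)) (nCk≡n!/k![n-k]! (m≤m+n a b)) ⟩
  ((a + b) ! ℕ./ (a ! * (a + b ∸ a) !)) * (a ! * (a + b ∸ a) !)         ≡⟨ m/n*n≡m (k![n∸k]!∣n! (m≤m+n a b)) ⟩
  (a + b) !                                                             ∎)
  where
  open ≡-Reasoning
  instance _ = a !* (a + b ∸ a) !≢0

count*C≡n! : ∀ (A B : FinSet n) {a b} → Disjoint A B → card A ≡ a → card B ≡ b → count (≺? A B) * ((a + b) C a) ≡ n !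
count*C≡n! {n} A B {a} {b} A#B refl refl = *-cancelʳ-≡ _ _ (a ! * b !) {{a !* b !≢0}} (begin
  count (≺? A B) * ((a + b) C a) * (a ! * b !)      ≡⟨ *-assoc (count (≺? A B)) _ _ ⟩
  count (≺? A B) * (((a + b) C a) * (a ! * b !))    ≡⟨ cong (count (≺? A B) *_) (C*a!b!≡[a+b]! a b) ⟩
  count (≺? A B) * (a + b) !                        ≡⟨ count-≺ A B A#B ⟩
  n ! * (a ! * b !)                                 ∎)
  where open ≡-Reasoning

-- The fraction c / (d + 1). The common denominator will be d + 1 = n!.
frac : ℕ → ℕ → ℚ
frac c d = fromℚᵘ (mkℚᵘ (+ c) d)

frac-+ : ∀ c c′ d → frac c d +ℚ frac c′ d ≡ frac (c + c′) d
frac-+ c c′ d = toℚᵘ-injective (begin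
  toℚᵘ (frac c d +ℚ frac c′ d)               ≈⟨ toℚᵘ-homo-+ (frac c d) (frac c′ d) ⟩
  toℚᵘ (frac c d) ℚᵘ.+ toℚᵘ (frac c′ d)      ≈⟨ ℚᵘ.+-cong (toℚᵘ-fromℚᵘ (mkℚᵘ (+ c) d)) (toℚᵘ-fromℚᵘ (mkℚᵘ (+ c′) d)) ⟩
  mkℚᵘ (+ c) d ℚᵘ.+ mkℚᵘ (+ c′) d            ≈⟨ *≡* (lemma (+ c) (+ c′) (+ suc d)) ⟩
  mkℚᵘ (+ c ℤ.+ + c′) d                      ≈⟨ ℚᵘ.≃-sym (toℚᵘ-fromℚᵘ (mkℚᵘ (+ (c + c′)) d)) ⟩
  toℚᵘ (frac (c + c′) d)                     ∎)
  where
  open ℚᵘ.≃-Reasoning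
  lemma : ∀ x y z → (x ℤ.* z ℤ.+ y ℤ.* z) ℤ.* z ≡ (x ℤ.+ y) ℤ.* (z ℤ.* z)
  lemma = ℤ-solve-∀

-- Cross-multiplication of 1 / k and c / (d + 1). Since c * k is positive, the convention for
-- `recip zero` never comes into play.
recip≡frac : ∀ k c d → c * k ≡ suc d → recip k ≡ frac c d
recip≡frac zero    c d ck≡ = contradiction (trans (sym (*-zeroʳ c)) ck≡) 0≢1+n
recip≡frac (suc k) c d ck≡ = fromℚᵘ-cong {mkℚᵘ (+ 1) k} {mkℚᵘ (+ c) d} (*≡* (trans (ℤ.*-identityˡ (+ suc d)) (trans (cong +_ (sym ck≡)) (ℤ.pos-* c (suc k)))))

sumℚ-frac : ∀ (f : Fin m → ℚ) (c : Fin m → ℕ) d → (∀ j → f j ≡ frac (c j) d) → sumℚ m f ≡ frac (sum c) d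
sumℚ-frac {zero}  f c d f≡ = fromℚᵘ-cong {mkℚᵘ (+ 0) 0} {mkℚᵘ (+ 0) d} (*≡* refl)
sumℚ-frac {suc m} f c d f≡ = trans (cong₂ _+ℚ_ (f≡ zero) (sumℚ-frac (f ∘ suc) (c ∘ suc) d (f≡ ∘ suc)))
                                   (frac-+ (c zero) (sum (c ∘ suc)) d)

frac-≤ : ∀ c d c′ d′ → c * suc d′ ≤ c′ * suc d → frac c d ≤ℚ frac c′ d′
frac-≤ c d c′ d′ h = toℚᵘ-cancel-≤ (begin
  toℚᵘ (frac c d)      ≃⟨ toℚᵘ-fromℚᵘ (mkℚᵘ (+ c) d) ⟩
  mkℚᵘ (+ c) d         ≤⟨ *≤* (subst₂ ℤ._≤_ (ℤ.pos-* c (suc d′)) (ℤ.pos-* c′ (suc d)) (ℤ.+≤+ h)) ⟩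
  mkℚᵘ (+ c′) d′       ≃⟨ ℚᵘ.≃-sym (toℚᵘ-fromℚᵘ (mkℚᵘ (+ c′) d′)) ⟩
  toℚᵘ (frac c′ d′)    ∎)
  where open ℚᵘ.≤-Reasoning

-- From `Subset` to characteristic functions

card-lookup : ∀ (p : Subset n) → card (lookup p) ≡ ∣ p ∣
card-lookup []          = refl
card-lookup (true  ∷ p) = cong suc (card-lookup p)
card-lookup (false ∷ p) = card-lookup p

card-lookup-∩ : ∀ (p q : Subset n) → card (lookup p ∩ᶠ lookup q) ≡ ∣ p ∩ q ∣
card-lookup-∩ p q = trans (card-cong (lookup p ∩ᶠ lookup q) (lookup (p ∩ q)) λ z → sym (lookup-zipWith _∧_ z p q)) (card-lookup (p ∩ q))

lookup-disjoint : ∀ (p q : Subset n) → p ∩ q ≡ ⊥ → Disjoint (lookup p) (lookup q)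
lookup-disjoint p q p∩q≡⊥ z z∈p z∈q = contradiction
  (trans (sym (∈-∩⁺ (lookup p) (lookup q) z∈p z∈q))
         (trans (sym (lookup-zipWith _∧_ z p q)) (trans (cong (λ r → lookup r z) p∩q≡⊥) (lookup-replicate z false))))
  λ ()

family-bound : {a b : Fin m → ℕ} → (∀ i → 2 ≤ a i) → (∀ i → 2 ≤ b i) → (F : Family a b n) →
  (∀ j → card (Family.A F j) ≡ a j) → (∀ j → card (Family.B F j) ≡ b j) →
  sumℚ m (λ i → recip ((a i + b i) C a i)) ≤ℚ (+ 29) / 30
-- The second `29` in `frac-≤` stands for the denominator 30.
family-bound {m} {n} {a} {b} 2≤a 2≤b F A≡a B≡b = subst (_≤ℚ (+ 29) / 30) (sym sum≡) (frac-≤ (sum k) d 29 29 (begin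
  sum k * 30           ≡⟨ *-comm (sum k) 30 ⟩
  30 * sum k           ≡⟨ cong (30 *_) (sum-cong-≗ λ j → sym (*-identityˡ (k j))) ⟩
  30 * CrossSystem.Total S ≤⟨ system-bound n S ⟩
  29 * n !             ≡⟨ cong (29 *_) n!≡1+d ⟩
  29 * suc d           ∎))
  where
  open ≤-Reasoning
  open Family F
  S : CrossSystem m n
  S = record
    { active = λ _ → true ; A = A ; B = B ; disjoint = disjoint
    ; cross = λ {i} {j} _ _ → cross i j
    ; 2≤A = λ {j} _ → subst (2 ≤_) (sym (A≡a j)) (2≤a j)
    ; 2≤B = λ {j} _ → subst (2 ≤_) (sym (B≡b j)) (2≤b j) }
  k : Fin m → ℕ
  k j = count (≺? (A j) (B j))
  d : ℕ
  d = pred (n !)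
  n!≡1+d : n ! ≡ suc d
  n!≡1+d = sym (suc-pred (n !) {{n !≢0}})
  sum≡ : sumℚ m (λ i → recip ((a i + b i) C a i)) ≡ frac (sum k) d
  sum≡ = sumℚ-frac _ k d λ j → recip≡frac ((a j + b j) C a j) (k j) d (trans (count*C≡n! (A j) (B j) (disjoint j) (A≡a j) (B≡b j)) n!≡1+d)

theorem3 : (m N : ℕ) → 1 ≤ m → (a b : Fin m → ℕ) →
    (∀ i → 2 ≤ a i) → (∀ i → 2 ≤ b i) →
    (A B : Fin m → Subset N) →
    (∀ i → A i ∩ B i ≡ ⊥) →
    (∀ i j → i ≢ j → ∣ A i ∩ B j ∣ ≡ 1) →
    (∀ i → ∣ A i ∣ ≤ a i) → (∀ i → ∣ B i ∣ ≤ b i) →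
    sumℚ m (λ i → recip ((a i + b i) C a i)) ≤ℚ ((+ 29) / 30)
theorem3 m N _ a b 2≤a 2≤b A B disjoint cross A≤a B≤b with saturate-both family
  where
  family : Family a b N
  family = record
    { A = lookup ∘ A ; B = lookup ∘ B
    ; disjoint = λ j → lookup-disjoint (A j) (B j) (disjoint j)
    ; cross = λ i j i≢j → trans (card-lookup-∩ (A i) (B j)) (cross i j i≢j)
    ; A≤a = λ j → subst (_≤ a j) (sym (card-lookup (A j))) (A≤a j)
    ; B≤b = λ j → subst (_≤ b j) (sym (card-lookup (B j))) (B≤b j) }
... | n , F , A≡a , B≡b = family-bound 2≤a 2≤b F A≡a B≡b
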